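{- Let $G$ be a bridgeless cubic graph with an even number of edges and let $k\ge1$. Then every graph $S_k(G)$ obtained by the construction below is a $4k$-edge-connected $4k$-graph that does not contain $4k-2$ pairwise disjoint perfect matchings.
   Context: Graphs may have parallel edges but no loops. An $r$-graph is an $r$-regular graph $H$ with $|\partial_H(S)|\ge r$ for every $S\subseteq V(H)$ of odd size, where $\partial_H(S)$ is the set of edges with exactly one end in $S$. Petersen graph $P$: vertices $v_1,\dots,v_5,u_1,\dots,u_5$, with 5-cycles $v_1v_2v_3v_4v_5$ and $u_1u_3u_5u_2u_4$ and edges $u_iv_i$. $M_0=\{u_iv_i\}_{i=1}^5$; for $i\in\{1,\dots,5\}$, $M_i$ is the unique perfect matching of $P$ other than $M_0$ containing $u_iv_i$. $P_k$ is obtained from $P$ by adding $k$ parallel copies of each edge of $M_0$ and $k-1$ parallel copies of each edge of $M_1$, $M_3$, $M_4$. $Q_k$ is obtained from two copies $P_k^1,P_k^2$ of $P_k$ by deleting all edges between $u_1^i$ and $v_1^i$ ($i=1,2$) and identifying $u_1^1$ with $u_1^2$. $T_k$ is the graph on three vertices $x_1,x_2,x_3$ with $k$ parallel edges between each pair. $S_k(G)$: replace each vertex $v$ of $G$ by a copy $T_k^v$ of $T_k$ and each edge $e$ of $G$ by a copy $Q_k^e$ of $Q_k$, with $v_1^1$ of $Q_k^e$ assigned to one end of $e$ and $v_1^2$ to the other. For each vertex $v$ with incident edges $e_1,e_2,e_3$, the vertex of $Q_k^{e_j}$ assigned to $v$ is joined by $k$ parallel edges to each of two vertices of $T_k^v$,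 the three pairs used for $e_1,e_2,e_3$ being the three distinct pairs $\{x_1,x_2\},\{x_2,x_3\},\{x_3,x_1\}$.
   Formalization: The bridgeless cubic graph G is additionally assumed connected and nonempty; for disconnected G (e.g. two disjoint copies of K_4) the graph S_k(G) is disconnected, hence not 4k-edge-connected, so the claim as written fails there. -}

module Defs where

open import Data.Bool using (T?; Bool; true; false; _∧_; _∨_; _xor_; not; if_then_else_)
open import Data.Nat using (ℕ; zero; suc; _+_; _*_; _∸_; _≤_; _<_; _%_)
open import Data.Fin using (Fin; zero; suc; #_; join; combine; _↑ˡ_; _↑ʳ_; _≟_)
open import Data.Fin.Subset using (Subset; ∣_∣; Nonempty; Empty; _∩_; ∁)
open import Data.List using (List; []; _∷_; _++_; length; lookup; concat; concatMap; replicate; allFin; map; filter)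
open import Data.Vec using (tabulate)
open import Data.Vec as Vec using ()
open import Data.Product using (_×_; _,_; proj₁; proj₂; ∃)
open import Data.Sum using (inj₁; inj₂)
open import Relation.Nullary using (¬_; ⌊_⌋)
open import Relation.Binary.PropositionalEquality using (_≡_; _≢_)

-- Finite multigraphs (parallel edges allowed).  Vertices are Fin V;
-- the edges are the positions of the list `edges`, each with its two ends.

record Multigraph : Set where
  constructor mkGraph
  field
    V     : ℕ
    edges : List (Fin V × Fin V)

open Multigraph public

Edge : Multigraph → Set
Edge G = Fin (length (edges G))

nE : Multigraph → ℕ
nE G = length (edges G)

endpt : (G : Multigraph) → Edge G → Bool → Fin (V G)
endpt G e false = proj₁ (lookup (edges G) e)
endpt G e true  = proj₂ (lookup (edges G) e)

Loopless : Multigraph → Set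
Loopless G = ∀ e → endpt G e false ≢ endpt G e true

incident : (G : Multigraph) → Fin (V G) → Edge G → Bool
incident G v e = ⌊ endpt G e false ≟ v ⌋ ∨ ⌊ endpt G e true ≟ v ⌋

degree : (G : Multigraph) → Fin (V G) → ℕ
degree G v = ∣ tabulate (incident G v) ∣

Regular : ℕ → Multigraph → Set
Regular r G = ∀ v → degree G v ≡ r

cut : (G : Multigraph) → Subset (V G) → ℕ
cut G S = ∣ tabulate (λ e → Vec.lookup S (endpt G e false) xor Vec.lookup S (endpt G e true)) ∣

Odd : ℕ → Set
Odd n = n % 2 ≡ 1

Even : ℕ → Set
Even n = n % 2 ≡ 0

IsRGraph : ℕ → Multigraph → Set
IsRGraph r G = Regular r G × (∀ (S : Subset (V G)) → Odd ∣ S ∣ → r ≤ cut G S)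

EdgeConnected : ℕ → Multigraph → Set
EdgeConnected r G = ∀ (S : Subset (V G)) → Nonempty S → Nonempty (∁ S) → r ≤ cut G S

Connected : Multigraph → Set
Connected G = (0 < V G) × EdgeConnected 1 G

Bridgeless : Multigraph → Set
Bridgeless G = ∀ (S : Subset (V G)) → ¬ (cut G S ≡ 1)

PerfectMatching : (G : Multigraph) → Subset (nE G) → Set
PerfectMatching G M = ∀ v → ∣ tabulate (λ e → Vec.lookup M e ∧ incident G v e) ∣ ≡ 1

HasDisjointPMs : ℕ → Multigraph → Set
HasDisjointPMs t G = ∃ λ (M : Fin t → Subset (nE G)) →
  (∀ i → PerfectMatching G (M i)) × (∀ i j → i ≢ j → Empty (M i ∩ M j))

u₁ u₂ u₃ u₄ u₅ v₁ v₂ v₃ v₄ v₅ : Fin 10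
u₁ = # 0
u₂ = # 1
u₃ = # 2
u₄ = # 3
u₅ = # 4
v₁ = # 5
v₂ = # 6
v₃ = # 7
v₄ = # 8
v₅ = # 9

petersenEdges : List (Fin 10 × Fin 10)
petersenEdges =
  (v₁ , v₂) ∷ (v₂ , v₃) ∷ (v₃ , v₄) ∷ (v₄ , v₅) ∷ (v₅ , v₁) ∷
  (u₁ , u₃) ∷ (u₃ , u₅) ∷ (u₅ , u₂) ∷ (u₂ , u₄) ∷ (u₄ , u₁) ∷
  (u₁ , v₁) ∷ (u₂ , v₂) ∷ (u₃ , v₃) ∷ (u₄ , v₄) ∷ (u₅ , v₅) ∷ []

M₀ : List (Fin 10 × Fin 10)
M₀ = (u₁ , v₁) ∷ (u₂ , v₂) ∷ (u₃ , v₃) ∷ (u₄ , v₄) ∷ (u₅ , v₅) ∷ []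

-- Mᵢ = the unique perfect matching ≠ M₀ containing uᵢvᵢ (written out explicitly)
M₁ M₃ M₄ : List (Fin 10 × Fin 10)
M₁ = (u₁ , v₁) ∷ (v₂ , v₃) ∷ (v₄ , v₅) ∷ (u₃ , u₅) ∷ (u₂ , u₄) ∷ []
M₃ = (u₃ , v₃) ∷ (v₄ , v₅) ∷ (v₁ , v₂) ∷ (u₅ , u₂) ∷ (u₄ , u₁) ∷ []
M₄ = (u₄ , v₄) ∷ (v₅ , v₁) ∷ (v₂ , v₃) ∷ (u₁ , u₃) ∷ (u₅ , u₂) ∷ []

PkEdges : ℕ → List (Fin 10 × Fin 10)
PkEdges k = petersenEdges ++ concat (replicate k M₀)
            ++ concat (replicate (k ∸ 1) (M₁ ++ M₃ ++ M₄))

isU₁V₁ : Fin 10 × Fin 10 → Bool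
isU₁V₁ (a , b) = (⌊ a ≟ u₁ ⌋ ∧ ⌊ b ≟ v₁ ⌋) ∨ (⌊ a ≟ v₁ ⌋ ∧ ⌊ b ≟ u₁ ⌋)

-- Q_k: vertices Fin 19.  Copy false (= P_k^1) occupies 0..9 (identity);
-- copy true (= P_k^2) sends u₁ (= index 0) to 0, i.e. u₁¹ and u₁² are
-- identified, and its other vertices to 10..18.
qv : Bool → Fin 10 → Fin 19
qv false p       = p ↑ˡ 9
qv true  zero    = zero
qv true  (suc p) = 10 ↑ʳ p

PkMinusEdges : ℕ → List (Fin 10 × Fin 10)
PkMinusEdges k = filter (λ p → T? (not (isU₁V₁ p))) (PkEdges k)

QkEdges : ℕ → List (Fin 19 × Fin 19)
QkEdges k = map (λ p → qv false (proj₁ p) , qv false (proj₂ p)) (PkMinusEdges k)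
         ++ map (λ p → qv true (proj₁ p) , qv true (proj₂ p)) (PkMinusEdges k)

-- T_k has vertices x₁,x₂,x₃ = Fin 3 indices 0,1,2.  Pair p ∈ Fin 3 is
-- {x_p, x_(p+1 mod 3)}: 0 ↦ {x₁,x₂}, 1 ↦ {x₂,x₃}, 2 ↦ {x₃,x₁}.
nxt : Fin 3 → Fin 3
nxt zero          = suc zero
nxt (suc zero)    = suc (suc zero)
nxt (suc (suc zero)) = zero

-- Choice data for S_k(G):
--  σ e : Bool   -- false: v₁¹ of Q_k^e is assigned to end `false` of e and v₁² to
--                  end `true`; true: the other way round.
--  π e j : Fin 3 -- the pair of T_k^(endpt e j) used by the vertex of Q_k^e
--                  assigned to end j of e.
-- ValidPairs: at every vertex the incident edge-ends use distinct pairs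
-- (G cubic, so the three pairs are all used exactly once).
ValidPairs : (G : Multigraph) → (Edge G → Bool → Fin 3) → Set
ValidPairs G π = ∀ e e' j j' → endpt G e j ≡ endpt G e' j' → π e j ≡ π e' j' →
                 (e ≡ e') × (j ≡ j')

S : (k : ℕ) (G : Multigraph) → (Edge G → Bool) → (Edge G → Bool → Fin 3) → Multigraph
S k G σ π = mkGraph N (TE ++ QE ++ LE)
  where
  N = V G * 3 + nE G * 19
  tv : Fin (V G) → Fin 3 → Fin N
  tv v x = join (V G * 3) (nE G * 19) (inj₁ (combine v x))
  qS : Edge G → Fin 19 → Fin N
  qS e q = join (V G * 3) (nE G * 19) (inj₂ (combine e q))
  x₁ x₂ x₃ : Fin 3
  x₁ = zero
  x₂ = suc zero
  x₃ = suc (suc zero)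
  TE = concatMap (λ v → concat (replicate k
         ((tv v x₁ , tv v x₂) ∷ (tv v x₂ , tv v x₃) ∷ (tv v x₃ , tv v x₁) ∷ [])))
         (allFin (V G))
  QE = concatMap (λ e → map (λ p → qS e (proj₁ p) , qS e (proj₂ p)) (QkEdges k))
         (allFin (nE G))
  link : Edge G → Bool → List (Fin N × Fin N)
  link e j = replicate k (w , tv t (π e j)) ++ replicate k (w , tv t (nxt (π e j)))
    where
    w = qS e (qv (j xor σ e) v₁)
    t = endpt G e j
  LE = concatMap (λ e → link e false ++ link e true) (allFin (nE G))

{-# OPTIONS --safe #-}
module Submission where

open import Defs
open import Data.Bool using (Bool; true; false; _∧_; _∨_; _xor_; not; if_then_else_; T?)
open import Data.Bool.Properties using (¬-not) renaming (_≟_ to _≟ᴮ_)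
open import Data.Nat hiding (_≟_)
open import Data.Nat.Properties renaming (_≟_ to _≟ᴺ_)
open import Data.Fin using (Fin; zero; suc; _≟_; #_; join; combine; splitAt; remQuot; fromℕ<)
open import Data.Fin.Subset using (Subset; ∣_∣; Empty; _∩_; Nonempty; ∁) renaming (_∈_ to _∈ˢ_)
open import Data.Fin.Subset.Properties using (anySubset?; x∈∁p⇒x∉p; x∉p⇒x∈∁p; nonempty?; Empty-unique; ∣⊥∣≡0; ∣∁p∣≡n∸∣p∣; ∣p∣≤n)
open import Data.List using (List; []; _∷_; _++_; length; lookup; concat; concatMap; replicate; allFin; map; filter)
open import Data.List.Properties using (map-tabulate; filter-++; map-++; map-∘; map-concatMap; concatMap-cong; map-replicate)
open import Data.Vec as Vec using (Vec; []; _∷_; tabulate; here; there)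
open import Data.Product using (_×_; _,_; proj₁; proj₂; ∃)
open import Data.Sum using (_⊎_; inj₁; inj₂)
open import Function using (_∘_; id)
open import Relation.Nullary using (¬_; ⌊_⌋; yes; no; contradiction; Dec)
open import Relation.Binary.PropositionalEquality using (_≡_; _≢_; _≗_; refl; sym; trans; cong; cong₂; subst; module ≡-Reasoning)
open import Algebra.Properties.Semiring.Sum +-*-semiring using (sum; sum-cong-≗; ∑-distrib-+; ∑-comm; *-distribˡ-sum; *-distribʳ-sum)
open import Data.Nat.Tactic.RingSolver using (solve-∀)
open import Data.Nat.Divisibility using (_∣_; _∣?_; divides; m%n≡0⇒n∣m; n∣m⇒m%n≡0; ∣m⇒∣m*n; ∣m+n∣m⇒∣n; ∣m∣n⇒∣m+n; m∣m*n; _∣0)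
open import Data.Fin.Properties using (all?; any?; join-splitAt; splitAt-join; combine-injective; combine-remQuot; ¬∀⟶∃¬)
open import Data.List.Membership.Propositional using (_∈_)
open import Data.List.Membership.DecPropositional {A = Fin 14} _≟_ using (_∈?_)
open import Data.List.Relation.Unary.Any using (here; there)
open import Data.Vec.Properties using (lookup∘tabulate; []=⇒lookup; lookup⇒[]=)
open import Relation.Nullary.Decidable using (from-yes; from-no; ¬?; _×-dec_; _⊎-dec_; _→-dec_; decidable-stable; map′)
open import Data.Sum.Properties using (inj₁-injective; inj₂-injective)
open import Data.Empty using (⊥)

-- An odd vertex set of S_k(G) meets every perfect matching in an odd number of boundary edges, so each
-- matching uses exactly one of the 4k links of a Q_k^e, and it restricts to a perfect matching of each of
-- the two copies of the Petersen graph, the link playing the part of u₁v₁.  Of the 4k - 2 matchings, neither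
-- end of e can carry just 2k - 2 links: in that copy 2k matchings avoid u₁v₁, and the multiplicities of P_k
-- then prescribe how often three edges are used (1, k and k times), an odd total, although every perfect
-- matching of the Petersen graph uses an even number of those three edges.  Hence both ends of e carry 2k - 1
-- links, and 3(2k - 1) links arrive at a triangle T_k^v.  But every matching uses an odd number of links
-- at T_k^v, so 4k - 2 of them use an even number in total.
--
-- For connectivity, a split triangle together with its links is cut 4k times.  If no triangle is split,
-- the walk v - v₁¹ - u₁ - v₁² - w through the gadget of an edge vw costs 2k at each change of side, and a copy
-- of P_k split without separating u₁ from v₁ costs 4k by itself; bridgelessness supplies two crossing edges.

-- Finite sums

private variable
  A B : Set
  n : ℕ

𝟙 : Bool → ℕ
𝟙 b = if b then 1 else 0

δ : Fin n → Fin n → ℕ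
δ i j = 𝟙 ⌊ i ≟ j ⌋

δᴮ : Bool → Bool → ℕ
δᴮ b c = 𝟙 (not (b xor c))

δ-refl : (i : Fin n) → δ i i ≡ 1
δ-refl i with i ≟ i
... | yes _ = refl
... | no i≢i = contradiction refl i≢i

δ-suc : (i j : Fin n) → δ (suc i) (suc j) ≡ δ i j
δ-suc i j with i ≟ j
... | yes _ = refl
... | no _ = refl

δ-subst : (i j : Fin n) (f : Fin n → ℕ) → δ i j * f i ≡ δ i j * f j
δ-subst i j f with i ≟ j
... | yes refl = refl
... | no _ = refl

sum-zero : (f : Fin n → ℕ) → (∀ i → f i ≡ 0) → sum f ≡ 0
sum-zero {zero} f f≡0 = refl
sum-zero {suc n} f f≡0 = cong₂ _+_ (f≡0 zero) (sum-zero (f ∘ suc) (f≡0 ∘ suc))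

sum-const : ∀ n c → sum {n} (λ _ → c) ≡ n * c
sum-const zero c = refl
sum-const (suc n) c = cong (c +_) (sum-const n c)

sum-δ : (j : Fin n) (f : Fin n → ℕ) → sum (λ i → δ i j * f i) ≡ f j
sum-δ zero f = trans (cong₂ _+_ (*-identityˡ (f zero)) (sum-zero (λ i → δ (suc i) zero * f (suc i)) (λ _ → refl))) (+-identityʳ _)
sum-δ (suc j) f = trans (sum-cong-≗ (λ i → cong (_* f (suc i)) (δ-suc i j))) (sum-δ j (f ∘ suc))

sum-*ˡ : (c : ℕ) (f : Fin n → ℕ) → sum (λ i → c * f i) ≡ c * sum f
sum-*ˡ c f = sym (*-distribˡ-sum c f)

sum-mono : {f g : Fin n → ℕ} → (∀ i → f i ≤ g i) → sum f ≤ sum g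
sum-mono {zero} f≤g = z≤n
sum-mono {suc n} f≤g = +-mono-≤ (f≤g zero) (sum-mono (f≤g ∘ suc))

term≤sum : (f : Fin n → ℕ) (i : Fin n) → f i ≤ sum f
term≤sum f zero = m≤m+n _ _
term≤sum f (suc i) = ≤-trans (term≤sum (f ∘ suc) i) (m≤n+m _ _)

terms≤sum : (f : Fin n → ℕ) {i j : Fin n} → i ≢ j → f i + f j ≤ sum f
terms≤sum f {zero} {zero} i≢j = contradiction refl i≢j
terms≤sum f {zero} {suc j} _ = +-monoʳ-≤ (f zero) (term≤sum (f ∘ suc) j)
terms≤sum f {suc i} {zero} _ = subst (_≤ sum f) (+-comm (f zero) _) (+-monoʳ-≤ (f zero) (term≤sum (f ∘ suc) i))
terms≤sum f {suc i} {suc j} i≢j = ≤-trans (terms≤sum (f ∘ suc) (i≢j ∘ cong suc)) (m≤n+m _ _)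

sum≤1 : (f : Fin n → ℕ) → (∀ i → f i ≤ 1) → (∀ i j → 0 < f i → 0 < f j → i ≡ j) → sum f ≤ 1
sum≤1 {zero} f f≤1 unique = z≤n
sum≤1 {suc n} f f≤1 unique with f zero in eq | f≤1 zero
... | zero | _ = sum≤1 (f ∘ suc) (f≤1 ∘ suc) (λ i j p q → suc-inj (unique (suc i) (suc j) p q))
  where
  suc-inj : {i j : Fin n} → suc i ≡ suc j → i ≡ j
  suc-inj refl = refl
... | suc zero | s≤s z≤n = s≤s (≤-reflexive (sum-zero (f ∘ suc) rest≡0))
  where
  rest≡0 : ∀ i → f (suc i) ≡ 0
  rest≡0 i with f (suc i) in eq′
  ... | zero = refl
  ... | suc _ with unique zero (suc i) (subst (0 <_) (sym eq) (s≤s z≤n)) (subst (0 <_) (sym eq′) (s≤s z≤n))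
  ... | ()

sum-pos : (f : Fin n → ℕ) → 0 < sum f → ∃ λ i → 0 < f i
sum-pos {suc n} f p with f zero in eq
... | suc _ = zero , subst (0 <_) (sym eq) (s≤s z≤n)
... | zero with sum-pos (f ∘ suc) p
... | i , q = suc i , q

-- Weighted totals of lists

total : (A → ℕ) → List A → ℕ
total g [] = 0
total g (x ∷ xs) = g x + total g xs

total-++ : (g : A → ℕ) (xs ys : List A) → total g (xs ++ ys) ≡ total g xs + total g ys
total-++ g [] ys = refl
total-++ g (x ∷ xs) ys = trans (cong (g x +_) (total-++ g xs ys)) (sym (+-assoc (g x) _ _))

total-map : (g : B → ℕ) (h : A → B) (xs : List A) → total g (map h xs) ≡ total (g ∘ h) xs
total-map g h [] = refl
total-map g h (x ∷ xs) = cong (g (h x) +_) (total-map g h xs)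

total-replicate : (g : A → ℕ) (k : ℕ) (x : A) → total g (replicate k x) ≡ k * g x
total-replicate g zero x = refl
total-replicate g (suc k) x = cong (g x +_) (total-replicate g k x)

total-concat-replicate : (g : A → ℕ) (k : ℕ) (xs : List A) → total g (concat (replicate k xs)) ≡ k * total g xs
total-concat-replicate g zero xs = refl
total-concat-replicate g (suc k) xs =
  trans (total-++ g xs _) (cong (total g xs +_) (total-concat-replicate g k xs))

total-concatMap-allFin : (g : A → ℕ) (n : ℕ) (h : Fin n → List A) →
  total g (concatMap h (allFin n)) ≡ sum (λ i → total g (h i))
total-concatMap-allFin {A} g n h = trans (cong (total g ∘ concat) (map-tabulate id h)) (go n h)
  where
  go : ∀ n (h : Fin n → List A) → total g (concat (Data.List.tabulate h)) ≡ sum (λ i → total g (h i))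
  go zero h = refl
  go (suc n) h = trans (total-++ g (h zero) _) (cong (total g (h zero) +_) (go n (h ∘ suc)))

total-cong : {f g : A → ℕ} → f ≗ g → (xs : List A) → total f xs ≡ total g xs
total-cong f≗g [] = refl
total-cong f≗g (x ∷ xs) = cong₂ _+_ (f≗g x) (total-cong f≗g xs)

total-+ : (f g : A → ℕ) (xs : List A) → total (λ x → f x + g x) xs ≡ total f xs + total g xs
total-+ f g [] = refl
total-+ f g (x ∷ xs) = trans (cong (f x + g x +_) (total-+ f g xs)) (interchange (f x) (g x) _ _)
  where
  interchange : ∀ a b c d → a + b + (c + d) ≡ a + c + (b + d)
  interchange = solve-∀

total-zero : (xs : List A) → total (λ _ → 0) xs ≡ 0
total-zero [] = refl
total-zero (x ∷ xs) = total-zero xs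

total-* : (c : ℕ) (f : A → ℕ) (xs : List A) → total (λ x → c * f x) xs ≡ c * total f xs
total-* c f [] = sym (*-zeroʳ c)
total-* c f (x ∷ xs) = trans (cong (c * f x +_) (total-* c f xs)) (sym (*-distribˡ-+ c (f x) _))

total-sum : (f : Fin n → A → ℕ) (xs : List A) → total (λ x → sum (λ i → f i x)) xs ≡ sum (λ i → total (f i) xs)
total-sum {n} f [] = sym (sum-zero {n} (λ _ → 0) (λ _ → refl))
total-sum f (x ∷ xs) =
  trans (cong (sum (λ i → f i x) +_) (total-sum f xs)) (sym (∑-distrib-+ (λ i → f i x) (λ i → total (f i) xs)))

∣tabulate∣ : (p : Fin n → Bool) → ∣ tabulate p ∣ ≡ sum (𝟙 ∘ p)
∣tabulate∣ {zero} p = refl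
∣tabulate∣ {suc n} p with p zero
... | true = cong suc (∣tabulate∣ (p ∘ suc))
... | false = ∣tabulate∣ (p ∘ suc)

sum-lookup : (g : A → ℕ) (xs : List A) → sum (λ i → g (lookup xs i)) ≡ total g xs
sum-lookup g [] = refl
sum-lookup g (x ∷ xs) = cong (g x +_) (sum-lookup g xs)

module _ (h : A → B) where

  -- The subset is a set of edges of the graph, that is, of positions in `map h xs`, but the result
  -- is a list of labels. Weights on labels can then be totalled over a matching.
  select : (xs : List A) → Subset (length (map h xs)) → List A
  select [] [] = []
  select (x ∷ xs) (true ∷ M) = x ∷ select xs M
  select (x ∷ xs) (false ∷ M) = select xs M

  total-select : (p : B → Bool) (xs : List A) (M : Subset (length (map h xs))) →
    ∣ tabulate (λ i → Vec.lookup M i ∧ p (lookup (map h xs) i)) ∣ ≡ total (𝟙 ∘ p ∘ h) (select xs M)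
  total-select p xs M = trans (∣tabulate∣ (λ i → Vec.lookup M i ∧ p (lookup (map h xs) i))) (go xs M)
    where
    go : ∀ xs M → sum (λ i → 𝟙 (Vec.lookup M i ∧ p (lookup (map h xs) i))) ≡ total (𝟙 ∘ p ∘ h) (select xs M)
    go [] [] = refl
    go (x ∷ xs) (true ∷ M) = cong (𝟙 (p (h x)) +_) (go xs M)
    go (x ∷ xs) (false ∷ M) = go xs M

  -- Disjointness lets at most one `M i` take a given position, so no entry is counted more often
  -- than it occurs in `xs`. This is how multiplicities become upper bounds for all the matchings
  -- together.
  select-disjoint : (g : A → ℕ) (xs : List A) {t : ℕ} (M : Fin t → Subset (length (map h xs))) →
    (∀ i j → i ≢ j → Empty (M i ∩ M j)) → sum (λ i → total g (select xs (M i))) ≤ total g xs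
  select-disjoint g [] {t} M disj = ≤-reflexive (sum-zero _ (λ i → none (M i)))
    where
    none : ∀ M → total g (select [] M) ≡ 0
    none [] = refl
  select-disjoint g (x ∷ xs) M disj = begin
    sum (λ i → total g (select (x ∷ xs) (M i)))                  ≡⟨ sum-cong-≗ (λ i → split (M i)) ⟩
    sum (λ i → g x * head i + tail i)                            ≡⟨ ∑-distrib-+ (λ i → g x * head i) tail ⟩
    sum (λ i → g x * head i) + sum tail                          ≡⟨ cong (_+ sum tail) (sum-*ˡ (g x) head) ⟩
    g x * sum head + sum tail                                    ≤⟨ +-mono-≤ (*-monoʳ-≤ (g x) head≤1) tails ⟩
    g x * 1 + total g xs                                         ≡⟨ cong (_+ total g xs) (*-identityʳ (g x)) ⟩
    g x + total g xs                                             ∎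
    where
    open ≤-Reasoning
    head tail : Fin _ → ℕ
    head i = 𝟙 (Vec.head (M i))
    tail i = total g (select xs (Vec.tail (M i)))
    split : ∀ M → total g (select (x ∷ xs) M) ≡ g x * 𝟙 (Vec.head M) + total g (select xs (Vec.tail M))
    split (true ∷ M) = cong (_+ total g (select xs M)) (sym (*-identityʳ (g x)))
    split (false ∷ M) = cong (_+ total g (select xs M)) (sym (*-zeroʳ (g x)))
    𝟙≤1 : ∀ b → 𝟙 b ≤ 1
    𝟙≤1 true = s≤s z≤n
    𝟙≤1 false = z≤n
    both : ∀ {l} (p q : Subset (suc l)) → 0 < 𝟙 (Vec.head p) → 0 < 𝟙 (Vec.head q) → ¬ Empty (p ∩ q)
    both (true ∷ p) (true ∷ q) _ _ empty = empty (zero , here)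
    rest : ∀ {l} (p q : Subset (suc l)) → Empty (p ∩ q) → Empty (Vec.tail p ∩ Vec.tail q)
    rest (_ ∷ p) (_ ∷ q) empty (y , y∈) = empty (suc y , there y∈)
    head≤1 : sum head ≤ 1
    head≤1 = sum≤1 head (λ i → 𝟙≤1 (Vec.head (M i))) unique
      where
      unique : ∀ i j → 0 < head i → 0 < head j → i ≡ j
      unique i j p q with i ≟ j
      ... | yes i≡j = i≡j
      ... | no i≢j = contradiction (disj i j i≢j) (both (M i) (M j) p q)
    tails : sum tail ≤ total g xs
    tails = select-disjoint g xs (Vec.tail ∘ M) (λ i j i≢j → rest (M i) (M j) (disj i j i≢j))

-- The Petersen graph

-- u₁v₁ is left out: its copies are not in Q_k, and the links at v₁ take its place.
petersenEdge : Fin 14 → Fin 10 × Fin 10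
petersenEdge f = Vec.lookup
  ((v₁ , v₂) ∷ (v₂ , v₃) ∷ (v₃ , v₄) ∷ (v₄ , v₅) ∷ (v₅ , v₁) ∷
   (u₁ , u₃) ∷ (u₃ , u₅) ∷ (u₅ , u₂) ∷ (u₂ , u₄) ∷ (u₄ , u₁) ∷
   (u₂ , v₂) ∷ (u₃ , v₃) ∷ (u₄ , v₄) ∷ (u₅ , v₅) ∷ []) f

src tgt : Fin 14 → Fin 10
src f = proj₁ (petersenEdge f)
tgt f = proj₂ (petersenEdge f)

-- The labels of M₀, and of M₁, M₃, M₄ in succession, without u₁v₁. They keep the order of the edge
-- lists that they replace, and repetitions count as parallel edges.
spokes M₁₃₄ : List (Fin 14)
spokes = # 10 ∷ # 11 ∷ # 12 ∷ # 13 ∷ []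
M₁₃₄ = # 1 ∷ # 3 ∷ # 6 ∷ # 8 ∷ # 11 ∷ # 3 ∷ # 0 ∷ # 7 ∷ # 9 ∷ # 12 ∷ # 4 ∷ # 1 ∷ # 5 ∷ # 7 ∷ []

-- P_{m+1} without u₁v₁ weighs Λ₀ + m Λ₁, so that bounds linear in m are checked on the two coefficients.
Λ₀ Λ₁ : (Fin 14 → ℕ) → ℕ
Λ₀ h = total h (allFin 14 ++ spokes)
Λ₁ h = total h (spokes ++ M₁₃₄)

-- The exhaustive search `anySubset?` decides an existence, so a universal claim enters as the
-- absence of a counterexample; decidability removes the double negation.
forAllSubsets : {n : ℕ} {P : Subset n → Set} (P? : ∀ s → Dec (P s)) →
  ¬ (∃ λ s → ¬ P s) → ∀ s → P s
forAllSubsets P? ¬∃ s = decidable-stable (P? s) (λ ¬p → ¬∃ (s , ¬p))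

-- Cuts of the Petersen graph

χ : (Fin 10 → Bool) → Fin 14 → ℕ
χ s f = 𝟙 (s (src f) xor s (tgt f))

-- A bound by c on both coefficients is a bound by c(1 + m) = ck in a copy of P_k without u₁v₁. So
-- separating u₁ from v₁ costs 2k, and any other colouring that is not constant costs 4k.
CutBound : (Fin 10 → Bool) → Set
CutBound s = ((2 * 𝟙 (s u₁ xor s v₁) ≤ Λ₀ (χ s)) × (2 * 𝟙 (s u₁ xor s v₁) ≤ Λ₁ (χ s))) ×
  ((∀ p → s p ≡ s u₁) ⊎ ((s u₁ xor s v₁ ≡ true) ⊎ ((4 ≤ Λ₀ (χ s)) × (4 ≤ Λ₁ (χ s)))))

cutBound? : ∀ s → Dec (CutBound s)
cutBound? s = ((_ ≤? _) ×-dec (_ ≤? _)) ×-dec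
  (all? (λ p → s p ≟ᴮ s u₁) ⊎-dec ((_ ≟ᴮ _) ⊎-dec ((_ ≤? _) ×-dec (_ ≤? _))))

subset-cutBound : ∀ s → CutBound (Vec.lookup s)
subset-cutBound = forAllSubsets (λ s → cutBound? (Vec.lookup s))
  (from-no (anySubset? (λ s → ¬? (cutBound? (Vec.lookup s)))))

-- Perfect matchings of the Petersen graph

incident₁₀ : Fin 10 → List (Fin 14)
incident₁₀ p = Vec.lookup
  ((# 5 ∷ # 9 ∷ []) ∷ (# 7 ∷ # 8 ∷ # 10 ∷ []) ∷ (# 5 ∷ # 6 ∷ # 11 ∷ []) ∷ (# 8 ∷ # 9 ∷ # 12 ∷ []) ∷
   (# 6 ∷ # 7 ∷ # 13 ∷ []) ∷ (# 0 ∷ # 4 ∷ []) ∷ (# 0 ∷ # 1 ∷ # 10 ∷ []) ∷ (# 1 ∷ # 2 ∷ # 11 ∷ []) ∷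
   (# 2 ∷ # 3 ∷ # 12 ∷ []) ∷ (# 3 ∷ # 4 ∷ # 13 ∷ []) ∷ []) p

star : (Fin 14 → ℕ) → ℕ → Fin 10 → ℕ
star x l p = total x (incident₁₀ p) + δ v₁ p * l

-- l stands for u₁v₁.  The vertex u₁ is shared by the two copies, hence only an inequality there.
Matching : (Fin 14 → ℕ) → ℕ → Set
Matching x l = (∀ (p : Fin 9) → star x l (suc p) ≡ 1) × (x (# 5) + x (# 9) ≤ 1)

-- In turn: u₁u₃ and u₄u₁; v₃v₄ and u₅u₂; v₃v₄, u₄u₁ and v₁v₂.
Pattern : (Fin 14 → ℕ) → ℕ → Set
Pattern x l = (x (# 5) + x (# 9) + l ≡ 1) × (x (# 2) + x (# 7) + l ≡ 1) × (2 ∣ x (# 2) + x (# 9) + x (# 0))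

bits : Subset 15 → Fin 14 → ℕ
bits s f = 𝟙 (Vec.lookup s (suc f))

bits-pattern? : ∀ s → Dec (Matching (bits s) (𝟙 (Vec.head s)) → Pattern (bits s) (𝟙 (Vec.head s)))
bits-pattern? s = (all? (λ _ → _ ≟ᴺ _) ×-dec (_ ≤? 1)) →-dec ((_ ≟ᴺ _) ×-dec ((_ ≟ᴺ _) ×-dec (2 ∣? _)))

-- All 0/1 assignments are tried. Adding the nine star equations shows that u₁u₃, u₄u₁ and l
-- together are used an odd number of times, hence once by the bounds, so the solutions are just the
-- six perfect matchings of P.
bits-pattern : ∀ s → Matching (bits s) (𝟙 (Vec.head s)) → Pattern (bits s) (𝟙 (Vec.head s))
bits-pattern = forAllSubsets bits-pattern? (from-no (anySubset? (λ s → ¬? (bits-pattern? s))))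

term≤total : (x : Fin 14 → ℕ) {f : Fin 14} (fs : List (Fin 14)) → f ∈ fs → x f ≤ total x fs
term≤total x (f ∷ fs) (here refl) = m≤m+n (x f) _
term≤total x (f ∷ fs) (there f∈) = ≤-trans (term≤total x fs f∈) (m≤n+m _ _)

-- At an end other than u₁ the star equation is exact, and it bounds the use of the edge by 1.
otherEnd : ∀ f → ∃ λ (p : Fin 9) → f ∈ incident₁₀ (suc p)
otherEnd = from-yes (all? λ f → any? λ p → f ∈? incident₁₀ (suc p))

-- The star equations force all values into {0, 1}, where rounding to bits changes nothing, so the
-- finite check on bits applies to counts.
matching-pattern : ∀ x l → Matching x l → Pattern x l
matching-pattern x l (stars , w≤1) =
    subst (λ y → y ≡ 1) (cong₂ _+_ (cong₂ _+_ (x≡ (# 5)) (x≡ (# 9))) l≡) p₁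
  , subst (λ y → y ≡ 1) (cong₂ _+_ (cong₂ _+_ (x≡ (# 2)) (x≡ (# 7))) l≡) p₂
  , subst (2 ∣_) (cong₂ _+_ (cong₂ _+_ (x≡ (# 2)) (x≡ (# 9))) (x≡ (# 0))) p₃
  where
  round : ∀ n → n ≤ 1 → 𝟙 (0 <ᵇ n) ≡ n
  round zero _ = refl
  round (suc zero) _ = refl
  round (suc (suc n)) (s≤s ())
  s : Subset 15
  s = (0 <ᵇ l) ∷ tabulate (λ f → 0 <ᵇ x f)
  l≡ : 𝟙 (Vec.head s) ≡ l
  -- `# 4` stands for v₁ = `suc (# 4)`, the vertex whose star contains l.
  l≡ = round l (≤-trans (m≤n+m l _) (≤-reflexive (trans (cong (total x (incident₁₀ v₁) +_) (sym (+-identityʳ l))) (stars (# 4)))))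
  x≤1 : ∀ f → x f ≤ 1
  x≤1 f with otherEnd f
  ... | p , f∈ = ≤-trans (term≤total x _ f∈) (≤-trans (m≤m+n _ _) (≤-reflexive (stars p)))
  x≡ : ∀ f → bits s f ≡ x f
  x≡ f = trans (cong 𝟙 (lookup∘tabulate (λ f → 0 <ᵇ x f) f)) (round (x f) (x≤1 f))
  star≡ : ∀ p → star (bits s) (𝟙 (Vec.head s)) p ≡ star x l p
  star≡ p = cong₂ _+_ (total-cong x≡ (incident₁₀ p)) (cong (δ v₁ p *_) l≡)
  bitMatching : Matching (bits s) (𝟙 (Vec.head s))
  bitMatching = (λ p → trans (star≡ (suc p)) (stars p)) , ≤-trans (≤-reflexive (cong₂ _+_ (x≡ (# 5)) (x≡ (# 9)))) w≤1
  p₁₂₃ = bits-pattern s bitMatching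
  p₁ = proj₁ p₁₂₃
  p₂ = proj₁ (proj₂ p₁₂₃)
  p₃ = proj₂ (proj₂ p₁₂₃)

-- The construction as a list of labelled edges

PkLabels : ℕ → List (Fin 14)
PkLabels m = allFin 14 ++ concat (replicate (suc m) spokes) ++ concat (replicate m M₁₃₄)

module _ {A B : Set} where

  map-concat-replicate : (f : A → B) (k : ℕ) (xs : List A) →
    concat (replicate k (map f xs)) ≡ map f (concat (replicate k xs))
  map-concat-replicate f zero xs = refl
  map-concat-replicate f (suc k) xs =
    trans (cong (map f xs ++_) (map-concat-replicate f k xs)) (sym (map-++ f xs _))

filter-concat-replicate : {A : Set} {P : A → Set} (P? : ∀ x → Dec (P x)) (k : ℕ) (xs : List A) →
  filter P? (concat (replicate k xs)) ≡ concat (replicate k (filter P? xs))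
filter-concat-replicate P? zero xs = refl
filter-concat-replicate P? (suc k) xs =
  trans (filter-++ P? xs _) (cong (filter P? xs ++_) (filter-concat-replicate P? k xs))

-- On the closed lists the filter is evaluated by computation; only the replications with symbolic
-- `m` have to be commuted with it.
PkMinusEdges≡ : ∀ m → PkMinusEdges (suc m) ≡ map petersenEdge (PkLabels m)
PkMinusEdges≡ m = begin
  filter P? (petersenEdges ++ concat (replicate (suc m) M₀) ++ concat (replicate m M))
    ≡⟨ filter-++ P? petersenEdges (concat (replicate (suc m) M₀) ++ concat (replicate m M)) ⟩
  map petersenEdge (allFin 14) ++ filter P? (concat (replicate (suc m) M₀) ++ concat (replicate m M))
    ≡⟨ cong (map petersenEdge (allFin 14) ++_) (filter-++ P? (concat (replicate (suc m) M₀)) (concat (replicate m M))) ⟩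
  map petersenEdge (allFin 14) ++ filter P? (concat (replicate (suc m) M₀)) ++ filter P? (concat (replicate m M))
    ≡⟨ cong (map petersenEdge (allFin 14) ++_) (cong₂ _++_ (reps (suc m) M₀ spokes refl) (reps m M M₁₃₄ refl)) ⟩
  map petersenEdge (allFin 14) ++ map petersenEdge (concat (replicate (suc m) spokes)) ++ map petersenEdge (concat (replicate m M₁₃₄))
    ≡⟨ cong (map petersenEdge (allFin 14) ++_) (map-++ petersenEdge (concat (replicate (suc m) spokes)) (concat (replicate m M₁₃₄))) ⟨
  map petersenEdge (allFin 14) ++ map petersenEdge (concat (replicate (suc m) spokes) ++ concat (replicate m M₁₃₄))
    ≡⟨ map-++ petersenEdge (allFin 14) (concat (replicate (suc m) spokes) ++ concat (replicate m M₁₃₄)) ⟨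
  map petersenEdge (PkLabels m) ∎
  where
  open ≡-Reasoning
  M = M₁ ++ M₃ ++ M₄
  P? = λ p → T? (not (isU₁V₁ p))
  reps : ∀ k xs ys → filter P? xs ≡ map petersenEdge ys →
    filter P? (concat (replicate k xs)) ≡ map petersenEdge (concat (replicate k ys))
  reps k xs ys eq = trans (filter-concat-replicate P? k xs)
    (trans (cong (concat ∘ replicate k) eq) (map-concat-replicate petersenEdge k ys))

-- Of the `suc m` rounds of `spokes`, one joins the constant term and the other m are paired with
-- the m rounds of `M₁₃₄`.
total-PkLabels : (h : Fin 14 → ℕ) (m : ℕ) → total h (PkLabels m) ≡ Λ₀ h + m * Λ₁ h
total-PkLabels h m = begin
  total h (PkLabels m)
    ≡⟨ total-++ h (allFin 14) (concat (replicate (suc m) spokes) ++ concat (replicate m M₁₃₄)) ⟩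
  base + total h (concat (replicate (suc m) spokes) ++ concat (replicate m M₁₃₄))
    ≡⟨ cong (base +_) (total-++ h (concat (replicate (suc m) spokes)) (concat (replicate m M₁₃₄))) ⟩
  base + (total h (concat (replicate (suc m) spokes)) + total h (concat (replicate m M₁₃₄)))
    ≡⟨ cong (base +_) (cong₂ _+_ (total-concat-replicate h (suc m) spokes) (total-concat-replicate h m M₁₃₄)) ⟩
  base + (suc m * total h spokes + m * total h M₁₃₄)
    ≡⟨ regroup base (total h spokes) (total h M₁₃₄) m ⟩
  (base + total h spokes) + m * (total h spokes + total h M₁₃₄)
    ≡⟨ cong₂ (λ x y → x + m * y) (total-++ h (allFin 14) spokes) (total-++ h spokes M₁₃₄) ⟨
  Λ₀ h + m * Λ₁ h ∎
  where
  open ≡-Reasoning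
  base = total h (allFin 14)
  regroup : ∀ x y z m → x + ((1 + m) * y + m * z) ≡ (x + y) + m * (y + z)
  regroup = solve-∀

∑ᴮ : (Bool → ℕ) → ℕ
∑ᴮ f = f false + f true

module Construction (G : Multigraph) (σ : Edge G → Bool) (π : Edge G → Bool → Fin 3) (m : ℕ) where

  k : ℕ
  k = suc m

  -- The vertices of S_k(G) before numbering: x in T_k^v, and q in Q_k^e.
  data Node : Set where
    tri : Fin (V G) → Fin 3 → Node
    pet : Edge G → Fin 19 → Node

  N : ℕ
  N = V G * 3 + nE G * 19

  enc : Node → Fin N
  enc (tri v x) = join (V G * 3) (nE G * 19) (inj₁ (combine v x))
  enc (pet e q) = join (V G * 3) (nE G * 19) (inj₂ (combine e q))

  dec : Fin N → Node
  dec w with splitAt (V G * 3) w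
  ... | inj₁ y = tri (proj₁ (remQuot {V G} 3 y)) (proj₂ (remQuot {V G} 3 y))
  ... | inj₂ y = pet (proj₁ (remQuot {nE G} 19 y)) (proj₂ (remQuot {nE G} 19 y))

  enc-dec : ∀ w → enc (dec w) ≡ w
  enc-dec w with splitAt (V G * 3) w | join-splitAt (V G * 3) (nE G * 19) w
  ... | inj₁ y | eq = trans (cong (join _ (nE G * 19) ∘ inj₁) (combine-remQuot {V G} 3 y)) eq
  ... | inj₂ y | eq = trans (cong (join (V G * 3) (nE G * 19) ∘ inj₂) (combine-remQuot {nE G} 19 y)) eq

  join-injective : ∀ x y → join (V G * 3) (nE G * 19) x ≡ join (V G * 3) (nE G * 19) y → x ≡ y
  join-injective x y eq = trans (sym (splitAt-join (V G * 3) (nE G * 19) x))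
    (trans (cong (splitAt (V G * 3)) eq) (splitAt-join (V G * 3) (nE G * 19) y))

  enc-injective : ∀ {w w′} → enc w ≡ enc w′ → w ≡ w′
  enc-injective {tri v x} {tri v′ x′} eq
    with combine-injective v x v′ x′ (inj₁-injective (join-injective (inj₁ (combine v x)) (inj₁ (combine v′ x′)) eq))
  ... | refl , refl = refl
  enc-injective {tri v x} {pet e q} eq with join-injective (inj₁ (combine v x)) (inj₂ (combine e q)) eq
  ... | ()
  enc-injective {pet e q} {tri v x} eq with join-injective (inj₂ (combine e q)) (inj₁ (combine v x)) eq
  ... | ()
  enc-injective {pet e q} {pet e′ q′} eq
    with combine-injective e q e′ q′ (inj₂-injective (join-injective (inj₂ (combine e q)) (inj₂ (combine e′ q′)) eq))
  ... | refl , refl = refl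

  -- Equality of nodes as a product of Kronecker deltas, so that sums over vertices or edges of G
  -- collapse factor by factor.
  at : Node → Node → ℕ
  at (tri v x) (tri v′ x′) = δ v v′ * δ x x′
  at (tri _ _) (pet _ _) = 0
  at (pet _ _) (tri _ _) = 0
  at (pet e q) (pet e′ q′) = δ e e′ * δ q q′

  at-refl : ∀ w → at w w ≡ 1
  at-refl (tri v x) = cong₂ _*_ (δ-refl v) (δ-refl x)
  at-refl (pet e q) = cong₂ _*_ (δ-refl e) (δ-refl q)

  δ*δ-≢ : ∀ {m n} {i i′ : Fin m} {j j′ : Fin n} → ¬ (i ≡ i′ × j ≡ j′) → δ i i′ * δ j j′ ≡ 0
  δ*δ-≢ {i = i} {i′} {j} {j′} ≢ with i ≟ i′ | j ≟ j′
  ... | yes p | yes q = contradiction (p , q) ≢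
  ... | yes p | no q = refl
  ... | no p | _ = refl

  at-≢ : ∀ w w′ → w ≢ w′ → at w w′ ≡ 0
  at-≢ (tri v x) (tri v′ x′) ≢ = δ*δ-≢ {i = v} {v′} {x} {x′} λ { (refl , refl) → ≢ refl }
  at-≢ (tri _ _) (pet _ _) ≢ = refl
  at-≢ (pet _ _) (tri _ _) ≢ = refl
  at-≢ (pet e q) (pet e′ q′) ≢ = δ*δ-≢ {i = e} {e′} {q} {q′} λ { (refl , refl) → ≢ refl }

  δ-enc : ∀ w w′ → δ (enc w) (enc w′) ≡ at w w′
  δ-enc w w′ with enc w ≟ enc w′
  ... | yes eq = trans (sym (at-refl w)) (cong (at w) (enc-injective eq))
  ... | no ≢ = sym (at-≢ w w′ (λ eq → ≢ (cong enc eq)))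

  -- Parallel edges share a label, and the multiplicities are found in `labels`. In `conE e j h` the
  -- link sits at end j of e, and h selects a vertex of the pair used there.
  data Label : Set where
    triE : Fin (V G) → Fin 3 → Label
    petE : Edge G → Bool → Fin 14 → Label
    conE : Edge G → Bool → Bool → Label

  pick : Bool → Fin 3 → Fin 3
  pick false p = p
  pick true p = nxt p

  ends : Label → Node × Node
  ends (triE v p) = tri v p , tri v (nxt p)
  ends (petE e c f) = pet e (qv c (src f)) , pet e (qv c (tgt f))
  ends (conE e j h) = pet e (qv (j xor σ e) v₁) , tri (endpt G e j) (pick h (π e j))

  encEnds : Label → Fin N × Fin N
  encEnds l = enc (proj₁ (ends l)) , enc (proj₂ (ends l))

  triLabels : Fin (V G) → List Label
  triLabels v = concat (replicate k (map (triE v) (allFin 3)))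

  petLabels conLabels : Edge G → List Label
  petLabels e = map (petE e false) (PkLabels m) ++ map (petE e true) (PkLabels m)
  conLabels e = (replicate k (conE e false false) ++ replicate k (conE e false true))
             ++ (replicate k (conE e true false) ++ replicate k (conE e true true))

  labels : List Label
  labels = concatMap triLabels (allFin (V G)) ++ concatMap petLabels (allFin (nE G))
        ++ concatMap conLabels (allFin (nE G))

  H : Multigraph
  H = mkGraph N (map encEnds labels)

  -- The edge lists agree entry by entry and in the same order, so the graphs are equal and not only
  -- isomorphic; every property can be transported.
  S≡H : S k G σ π ≡ H
  S≡H = cong (mkGraph N) (sym edges≡)
    where
    open ≡-Reasoning
    tri≡ : ∀ v → map encEnds (triLabels v) ≡ _
    tri≡ v = sym (map-concat-replicate encEnds k (map (triE v) (allFin 3)))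
    pet≡ : ∀ e → map encEnds (petLabels e) ≡ map (λ p → enc (pet e (proj₁ p)) , enc (pet e (proj₂ p))) (QkEdges k)
    pet≡ e = begin
      map encEnds (map (petE e false) (PkLabels m) ++ map (petE e true) (PkLabels m))
        ≡⟨ map-++ encEnds (map (petE e false) (PkLabels m)) _ ⟩
      map encEnds (map (petE e false) (PkLabels m)) ++ map encEnds (map (petE e true) (PkLabels m))
        ≡⟨ cong₂ _++_ (copy false) (copy true) ⟩
      map encE (map (qq false) (PkMinusEdges k)) ++ map encE (map (qq true) (PkMinusEdges k))
        ≡⟨ map-++ encE (map (qq false) (PkMinusEdges k)) _ ⟨
      map encE (QkEdges k) ∎
      where
      encE : Fin 19 × Fin 19 → Fin N × Fin N
      encE p = enc (pet e (proj₁ p)) , enc (pet e (proj₂ p))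
      qq : Bool → Fin 10 × Fin 10 → Fin 19 × Fin 19
      qq c p = qv c (proj₁ p) , qv c (proj₂ p)
      copy : ∀ c → map encEnds (map (petE e c) (PkLabels m)) ≡ map encE (map (qq c) (PkMinusEdges k))
      copy c = begin
        map encEnds (map (petE e c) (PkLabels m))          ≡⟨ map-∘ (PkLabels m) ⟨
        map (encE ∘ qq c ∘ petersenEdge) (PkLabels m)                ≡⟨ map-∘ (PkLabels m) ⟩
        map (encE ∘ qq c) (map petersenEdge (PkLabels m))            ≡⟨ map-∘ (map petersenEdge (PkLabels m)) ⟩
        map encE (map (qq c) (map petersenEdge (PkLabels m)))        ≡⟨ cong (map encE ∘ map (qq c)) (PkMinusEdges≡ m) ⟨
        map encE (map (qq c) (PkMinusEdges k))       ∎
    con≡ : ∀ e → map encEnds (conLabels e) ≡ _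
    con≡ e = begin
      map encEnds (conLabels e)
        ≡⟨ map-++ encEnds (r false false ++ r false true) _ ⟩
      map encEnds (r false false ++ r false true) ++ map encEnds (r true false ++ r true true)
        ≡⟨ cong₂ _++_ (two false) (two true) ⟩
      (s false false ++ s false true) ++ (s true false ++ s true true) ∎
      where
      r = λ j h → replicate k (conE e j h)
      s = λ j h → replicate k (encEnds (conE e j h))
      two : ∀ j → map encEnds (r j false ++ r j true) ≡ s j false ++ s j true
      two j = trans (map-++ encEnds (r j false) _) (cong₂ _++_ (map-replicate encEnds k _) (map-replicate encEnds k _))
    family : {n : ℕ} (f : Fin n → List Label) (g : Fin n → List (Fin N × Fin N)) →
      (∀ i → map encEnds (f i) ≡ g i) → map encEnds (concatMap f (allFin n)) ≡ concatMap g (allFin n)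
    family {n} f g f≡g = trans (map-concatMap encEnds f (allFin n)) (concatMap-cong f≡g (allFin n))
    edges≡ : map encEnds labels ≡ edges (S k G σ π)
    edges≡ = trans (map-++ encEnds (concatMap triLabels (allFin (V G))) _)
      (cong₂ _++_ (family triLabels _ tri≡)
      (trans (map-++ encEnds (concatMap petLabels (allFin (nE G))) _)
      (cong₂ _++_ (family petLabels _ pet≡) (family conLabels _ con≡))))

  -- Degrees, cut sizes and capacities are all totals over `labels`; each is computed from this
  -- decomposition into triangles, Petersen copies and links.
  total-labels : (g : Label → ℕ) → total g labels ≡
    sum (λ v → k * total (g ∘ triE v) (allFin 3)) +
    (sum (λ e → ∑ᴮ (λ c → Λ₀ (g ∘ petE e c) + m * Λ₁ (g ∘ petE e c))) +
     sum (λ e → ∑ᴮ (λ j → ∑ᴮ (λ h → k * g (conE e j h)))))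
  total-labels g = trans (total-++ g (concatMap triLabels (allFin (V G))) _) (cong₂ _+_
    (trans (total-concatMap-allFin g _ triLabels) (sum-cong-≗ λ v →
      trans (total-concat-replicate g k (map (triE v) (allFin 3)))
            (cong (k *_) (total-map g (triE v) (allFin 3)))))
    (trans (total-++ g (concatMap petLabels (allFin (nE G))) _) (cong₂ _+_
      (trans (total-concatMap-allFin g _ petLabels) (sum-cong-≗ λ e →
        trans (total-++ g (map (petE e false) (PkLabels m)) _) (cong₂ _+_ (copy e false) (copy e true))))
      (trans (total-concatMap-allFin g _ conLabels) (sum-cong-≗ λ e →
        trans (total-++ g (replicate k (conE e false false) ++ replicate k (conE e false true)) _)
              (cong₂ _+_ (links e false) (links e true)))))))
    where
    copy : ∀ e c → total g (map (petE e c) (PkLabels m)) ≡ Λ₀ (g ∘ petE e c) + m * Λ₁ (g ∘ petE e c)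
    copy e c = trans (total-map g (petE e c) (PkLabels m)) (total-PkLabels (g ∘ petE e c) m)
    links : ∀ e j → total g (replicate k (conE e j false) ++ replicate k (conE e j true)) ≡
      ∑ᴮ (λ h → k * g (conE e j h))
    links e j = trans (total-++ g (replicate k (conE e j false)) _)
      (cong₂ _+_ (total-replicate g k _) (total-replicate g k _))

-- Degrees

𝟙-∨ : ∀ {n} {x y v : Fin n} → x ≢ y → 𝟙 (⌊ x ≟ v ⌋ ∨ ⌊ y ≟ v ⌋) ≡ δ x v + δ y v
𝟙-∨ {x = x} {y} {v} x≢y with x ≟ v | y ≟ v
... | yes p | yes q = contradiction (trans p (sym q)) x≢y
... | yes _ | no _ = refl
... | no _ | yes _ = refl
... | no _ | no _ = refl

δ≤1 : ∀ {n} (i j : Fin n) → δ i j ≤ 1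
δ≤1 i j with i ≟ j
... | yes _ = s≤s z≤n
... | no _ = z≤n

δ-sym : ∀ {n} (i j : Fin n) → δ i j ≡ δ j i
δ-sym i j with i ≟ j | j ≟ i
... | yes _ | yes _ = refl
... | no _ | no _ = refl
... | yes p | no q = contradiction (sym p) q
... | no p | yes q = contradiction (sym q) p

sum-δˡ : ∀ {n} (i : Fin n) (f : Fin n → ℕ) → sum (λ j → δ i j * f j) ≡ f i
sum-δˡ i f = trans (sum-cong-≗ (λ j → cong (_* f j) (δ-sym i j))) (sum-δ i f)

sum-δʳ : ∀ {n} (i : Fin n) → sum (λ j → δ i j) ≡ 1
sum-δʳ i = trans (sum-cong-≗ (λ j → sym (*-identityʳ (δ i j)))) (sum-δˡ i (λ _ → 1))

degree≡ : (G : Multigraph) → Loopless G → ∀ v → degree G v ≡ sum (λ e → ∑ᴮ (λ j → δ (endpt G e j) v))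
degree≡ G loopless v = trans (∣tabulate∣ (incident G v)) (sum-cong-≗ (λ e → 𝟙-∨ (loopless e)))

nxt-≢ : ∀ p → p ≢ nxt p
nxt-≢ zero ()
nxt-≢ (suc zero) ()
nxt-≢ (suc (suc zero)) ()

-- `nxt` is a 3-cycle, so its square is its inverse.
prv : Fin 3 → Fin 3
prv p = nxt (nxt p)

δ-nxt : ∀ p x → δ (nxt p) x ≡ δ p (prv x)
δ-nxt = from-yes (all? λ p → all? λ x → δ (nxt p) x ≟ᴺ δ p (prv x))

qv-≢ : ∀ c f → qv c (src f) ≢ qv c (tgt f)
qv-≢ false = from-yes (all? λ f → ¬? (qv false (src f) ≟ qv false (tgt f)))
qv-≢ true = from-yes (all? λ f → ¬? (qv true (src f) ≟ qv true (tgt f)))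

incQ : Fin 19 → Bool → Fin 14 → ℕ
incQ q c f = δ (qv c (src f)) q + δ (qv c (tgt f)) q

atV₁ : Fin 19 → Bool → ℕ
atV₁ q c = δ (qv c v₁) q

-- The 2k = 2 + 2m links at v₁ contribute 2 to each coefficient. With both coefficients equal to 4
-- the degree is 4 + 4m = 4k; at the shared u₁ two halves of 2k meet.
degQ : ∀ q → (∑ᴮ (λ c → Λ₀ (incQ q c)) + 2 * ∑ᴮ (atV₁ q) ≡ 4) × (∑ᴮ (λ c → Λ₁ (incQ q c)) + 2 * ∑ᴮ (atV₁ q) ≡ 4)
degQ = from-yes (all? λ q → (∑ᴮ (λ c → Λ₀ (incQ q c)) + 2 * ∑ᴮ (atV₁ q) ≟ᴺ 4) ×-dec
                             (∑ᴮ (λ c → Λ₁ (incQ q c)) + 2 * ∑ᴮ (atV₁ q) ≟ᴺ 4))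

Λ₀-* : ∀ c h → Λ₀ (λ f → c * h f) ≡ c * Λ₀ h
Λ₀-* c h = total-* c h (allFin 14 ++ spokes)

Λ₁-* : ∀ c h → Λ₁ (λ f → c * h f) ≡ c * Λ₁ h
Λ₁-* c h = total-* c h (spokes ++ M₁₃₄)

Λ₀-cong : ∀ {g h} → g ≗ h → Λ₀ g ≡ Λ₀ h
Λ₀-cong g≗h = total-cong g≗h (allFin 14 ++ spokes)

Λ₁-cong : ∀ {g h} → g ≗ h → Λ₁ g ≡ Λ₁ h
Λ₁-cong g≗h = total-cong g≗h (spokes ++ M₁₃₄)

∑ᴮ-xor : ∀ s f → ∑ᴮ (λ j → f (j xor s)) ≡ ∑ᴮ f
∑ᴮ-xor false f = refl
∑ᴮ-xor true f = +-comm (f true) (f false)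

∀-xor : ∀ s (f : Bool → Bool) {y} → f (false xor s) ≡ y → f (true xor s) ≡ y → ∀ c → f c ≡ y
∀-xor false f p q false = p
∀-xor false f p q true = q
∀-xor true f p q false = q
∀-xor true f p q true = p

module Cubic (G : Multigraph) (loopless : Loopless G) (cubic : Regular 3 G)
  (σ : Edge G → Bool) (π : Edge G → Bool → Fin 3) (valid : ValidPairs G π) (m : ℕ) where

  open Construction G σ π m public

  at-end : Edge G → Bool → Fin (V G) → ℕ
  at-end e j v = δ (endpt G e j) v

  ends-sum : ∀ v → sum (λ e → ∑ᴮ (λ j → at-end e j v)) ≡ 3
  ends-sum v = trans (sym (degree≡ G loopless v)) (cubic v)

  uses : Fin (V G) → Fin 3 → Edge G → Bool → ℕ
  uses v p e j = at-end e j v * δ (π e j) p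

  uses-pos : ∀ {v p e j} → 0 < uses v p e j → endpt G e j ≡ v × π e j ≡ p
  uses-pos {v} {p} {e} {j} 0< with endpt G e j ≟ v | π e j ≟ p
  ... | yes x | yes y = x , y
  uses-pos () | yes _ | no _
  uses-pos () | no _ | _

  uses≤1 : ∀ v p e j → uses v p e j ≤ 1
  uses≤1 v p e j = *-mono-≤ (δ≤1 (endpt G e j) v) (δ≤1 (π e j) p)

  uses-unique : ∀ {v p e e′ j j′} → 0 < uses v p e j → 0 < uses v p e′ j′ → e ≡ e′ × j ≡ j′
  uses-unique {v} {p} {e} {e′} {j} {j′} p₁ p₂ with uses-pos {v} {p} {e} {j} p₁ | uses-pos {v} {p} {e′} {j′} p₂
  ... | x , y | x′ , y′ = valid e e′ j j′ (trans x (sym x′)) (trans y (sym y′))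

  some-end : ∀ {v p e} → 0 < ∑ᴮ (uses v p e) → ∃ λ j → 0 < uses v p e j
  some-end {v} {p} {e} 0< with uses v p e false in eq
  ... | suc _ = false , subst (0 <_) (sym eq) (s≤s z≤n)
  ... | zero = true , 0<

  -- `ValidPairs` lets each of the three pairs be used at most once at v. As v has exactly three
  -- edge ends, each pair is used.
  pair-used-once : ∀ v p → sum (λ e → ∑ᴮ (uses v p e)) ≡ 1
  pair-used-once v p = all-one p
    where
    count : Fin 3 → ℕ
    count p = sum (λ e → ∑ᴮ (uses v p e))
    count≤1 : ∀ p → count p ≤ 1
    count≤1 p = sum≤1 (λ e → ∑ᴮ (uses v p e)) each unique
      where
      unique : ∀ e e′ → 0 < ∑ᴮ (uses v p e) → 0 < ∑ᴮ (uses v p e′) → e ≡ e′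
      unique e e′ x y with some-end {v} {p} {e} x | some-end {v} {p} {e′} y
      ... | j , x′ | j′ , y′ = proj₁ (uses-unique {v} {p} {e} {e′} {j} {j′} x′ y′)
      each : ∀ e → ∑ᴮ (uses v p e) ≤ 1
      each e with uses v p e false in eq₀ | uses v p e true in eq₁ | uses≤1 v p e false | uses≤1 v p e true
      ... | zero | y | _ | y≤1 = y≤1
      ... | suc zero | zero | x≤1 | _ = x≤1
      ... | suc x | suc y | _ | _ with uses-unique {v} {p} {e} {e} {false} {true}
                                     (subst (0 <_) (sym eq₀) (s≤s z≤n)) (subst (0 <_) (sym eq₁) (s≤s z≤n))
      ... | _ , ()
      each e | suc (suc x) | y | s≤s () | _
    count-sum : sum count ≡ 3
    count-sum = begin
      sum (λ p → sum (λ e → ∑ᴮ (uses v p e)))   ≡⟨ ∑-comm (λ p e → ∑ᴮ (uses v p e)) ⟩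
      sum (λ e → sum (λ p → ∑ᴮ (uses v p e)))
        ≡⟨ sum-cong-≗ (λ e → trans (∑-distrib-+ (λ p → uses v p e false) (λ p → uses v p e true))
             (cong₂ _+_ (one e false) (one e true))) ⟩
      sum (λ e → ∑ᴮ (λ j → at-end e j v))       ≡⟨ ends-sum v ⟩
      3                                         ∎
      where
      open ≡-Reasoning
      one : ∀ e j → sum (λ p → uses v p e j) ≡ at-end e j v
      one e j = trans (sum-*ˡ (at-end e j v) (δ (π e j))) (trans (cong (at-end e j v *_) (sum-δʳ (π e j))) (*-identityʳ _))
    saturated : ∀ x y z → x ≤ 1 → y ≤ 1 → z ≤ 1 → x + (y + (z + 0)) ≡ 3 → x ≡ 1 × y ≡ 1 × z ≡ 1
    saturated .1 .1 .1 (s≤s z≤n) (s≤s z≤n) (s≤s z≤n) _ = refl , refl , refl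
    saturated _ _ _ z≤n z≤n z≤n ()
    saturated _ _ _ z≤n z≤n (s≤s z≤n) ()
    saturated _ _ _ z≤n (s≤s z≤n) z≤n ()
    saturated _ _ _ z≤n (s≤s z≤n) (s≤s z≤n) ()
    saturated _ _ _ (s≤s z≤n) z≤n z≤n ()
    saturated _ _ _ (s≤s z≤n) z≤n (s≤s z≤n) ()
    saturated _ _ _ (s≤s z≤n) (s≤s z≤n) z≤n ()
    all-one : ∀ p → count p ≡ 1
    all-one p with saturated _ _ _ (count≤1 (# 0)) (count≤1 (# 1)) (count≤1 (# 2)) count-sum
    all-one zero | x , y , z = x
    all-one (suc zero) | x , y , z = y
    all-one (suc (suc zero)) | x , y , z = z

  ends-≢ : ∀ l → proj₁ (ends l) ≢ proj₂ (ends l)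
  ends-≢ (triE v p) eq = nxt-≢ p (tri-injective eq)
    where
    tri-injective : ∀ {v p q} → tri v p ≡ tri v q → p ≡ q
    tri-injective refl = refl
  ends-≢ (petE e c f) eq = qv-≢ c f (pet-injective eq)
    where
    pet-injective : ∀ {e p q} → pet e p ≡ pet e q → p ≡ q
    pet-injective refl = refl
  ends-≢ (conE e j h) ()

  H-loopless : Loopless H
  H-loopless = go labels
    where
    go : ∀ ls (i : Fin (length (map encEnds ls))) →
      proj₁ (lookup (map encEnds ls) i) ≢ proj₂ (lookup (map encEnds ls) i)
    go (l ∷ ls) zero eq = ends-≢ l (enc-injective eq)
    go (l ∷ ls) (suc i) = go ls i

  inc : Node → Label → ℕ
  inc w l = at (proj₁ (ends l)) w + at (proj₂ (ends l)) w

  inc-enc : ∀ w l → 𝟙 (⌊ proj₁ (encEnds l) ≟ enc w ⌋ ∨ ⌊ proj₂ (encEnds l) ≟ enc w ⌋) ≡ inc w l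
  inc-enc w l = trans (𝟙-∨ (ends-≢ l ∘ enc-injective)) (cong₂ _+_ (δ-enc (proj₁ (ends l)) w) (δ-enc (proj₂ (ends l)) w))

  degree-enc : ∀ w → degree H (enc w) ≡ total (inc w) labels
  degree-enc w = begin
    degree H (enc w)                            ≡⟨ ∣tabulate∣ (incident H (enc w)) ⟩
    sum (λ i → g (lookup (map encEnds labels) i)) ≡⟨ sum-lookup g (map encEnds labels) ⟩
    total g (map encEnds labels)                ≡⟨ total-map g encEnds labels ⟩
    total (g ∘ encEnds) labels                  ≡⟨ total-cong (inc-enc w) labels ⟩
    total (inc w) labels                        ∎
    where
    open ≡-Reasoning
    g : Fin N × Fin N → ℕ
    g p = 𝟙 (⌊ proj₁ p ≟ enc w ⌋ ∨ ⌊ proj₂ p ≟ enc w ⌋)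

  -- A triangle vertex x has 2k edges inside its triangle. It lies in the pairs x and `prv x`, each
  -- used by one edge end, and receives k links through each. At the other vertices `degQ` gives the
  -- count.
  total-inc : ∀ w → total (inc w) labels ≡ 4 * k
  total-inc (tri v x) = trans (total-labels (inc (tri v x))) (trans
    (cong₂ _+_ triangles (cong₂ _+_ (sum-zero {nE G} _ (λ e → cong₂ _+_ (*-zeroʳ m) (*-zeroʳ m))) links))
    (numbers k))
    where
    numbers : ∀ k → k * 2 + (0 + (k * 1 + k * 1)) ≡ 4 * k
    numbers = solve-∀
    triangles : sum (λ v′ → k * total (inc (tri v x) ∘ triE v′) (allFin 3)) ≡ k * 2
    triangles = trans (sum-cong-≗ (λ v′ → at-triangle (δ v′ v) x)) (sum-δ v (λ _ → k * 2))
      where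
      ring₀ : ∀ k d → k * (d * 1 + d * 0 + (d * 0 + d * 0 + (d * 0 + d * 1 + 0))) ≡ d * (k * 2)
      ring₀ = solve-∀
      ring₁ : ∀ k d → k * (d * 0 + d * 1 + (d * 1 + d * 0 + (d * 0 + d * 0 + 0))) ≡ d * (k * 2)
      ring₁ = solve-∀
      ring₂ : ∀ k d → k * (d * 0 + d * 0 + (d * 0 + d * 1 + (d * 1 + d * 0 + 0))) ≡ d * (k * 2)
      ring₂ = solve-∀
      at-triangle : ∀ d x → k * total (λ p → d * δ p x + d * δ (nxt p) x) (allFin 3) ≡ d * (k * 2)
      at-triangle d zero = ring₀ k d
      at-triangle d (suc zero) = ring₁ k d
      at-triangle d (suc (suc zero)) = ring₂ k d
    links : sum (λ e → ∑ᴮ (λ j → ∑ᴮ (λ h → k * (at-end e j v * δ (pick h (π e j)) x)))) ≡ k * 1 + k * 1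
    links = begin
      sum (λ e → ∑ᴮ (λ j → ∑ᴮ (λ h → k * (at-end e j v * δ (pick h (π e j)) x))))
        ≡⟨ sum-cong-≗ (λ e → trans (regroup k (uses v x e false) (at-end e false v * δ (nxt (π e false)) x) (uses v x e true) _)
             (cong₂ (λ y z → k * ∑ᴮ (uses v x e) + k * (y + z)) (cong (at-end e false v *_) (δ-nxt (π e false) x))
                                                                 (cong (at-end e true v *_) (δ-nxt (π e true) x)))) ⟩
      sum (λ e → k * ∑ᴮ (uses v x e) + k * ∑ᴮ (uses v (prv x) e))
        ≡⟨ ∑-distrib-+ (λ e → k * ∑ᴮ (uses v x e)) (λ e → k * ∑ᴮ (uses v (prv x) e)) ⟩
      sum (λ e → k * ∑ᴮ (uses v x e)) + sum (λ e → k * ∑ᴮ (uses v (prv x) e))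
        ≡⟨ cong₂ _+_ (once x) (once (prv x)) ⟩
      k * 1 + k * 1 ∎
      where
      open ≡-Reasoning
      regroup : ∀ k a b c d → k * a + k * b + (k * c + k * d) ≡ k * (a + c) + k * (b + d)
      regroup = solve-∀
      once : ∀ p → sum (λ e → k * ∑ᴮ (uses v p e)) ≡ k * 1
      once p = trans (sum-*ˡ k (λ e → ∑ᴮ (uses v p e))) (cong (k *_) (pair-used-once v p))
  total-inc (pet e q) = trans (total-labels (inc (pet e q))) (trans
    (cong₂ _+_ (sum-zero {V G} _ (λ v → *-zeroʳ k)) (cong₂ _+_ copies links))
    (numbers (∑ᴮ (λ c → Λ₀ (incQ q c))) (∑ᴮ (λ c → Λ₁ (incQ q c))) (∑ᴮ (atV₁ q)) (proj₁ (degQ q)) (proj₂ (degQ q))))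
    where
    open ≡-Reasoning
    numbers : ∀ x y z → x + 2 * z ≡ 4 → y + 2 * z ≡ 4 → 0 + ((x + m * y) + 2 * k * z) ≡ 4 * k
    numbers x y z p₀ p₁ = begin
      (x + m * y) + 2 * suc m * z             ≡⟨ ring x y z m ⟩
      (x + 2 * z) + m * (y + 2 * z)           ≡⟨ cong₂ (λ s t → s + m * t) p₀ p₁ ⟩
      4 + m * 4                               ≡⟨ ring′ m ⟩
      4 * suc m                               ∎
      where
      ring : ∀ x y z m → (x + m * y) + 2 * (1 + m) * z ≡ (x + 2 * z) + m * (y + 2 * z)
      ring = solve-∀
      ring′ : ∀ m → 4 + m * 4 ≡ 4 * (1 + m)
      ring′ = solve-∀
    copies : sum (λ e′ → ∑ᴮ (λ c → Λ₀ (inc (pet e q) ∘ petE e′ c) + m * Λ₁ (inc (pet e q) ∘ petE e′ c)))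
      ≡ ∑ᴮ (λ c → Λ₀ (incQ q c)) + m * ∑ᴮ (λ c → Λ₁ (incQ q c))
    copies = trans (sum-cong-≗ (λ e′ → trans (cong₂ _+_ (copy e′ false) (copy e′ true))
               (ring (δ e′ e) m (Λ₀ (incQ q false)) (Λ₁ (incQ q false)) (Λ₀ (incQ q true)) (Λ₁ (incQ q true)))))
             (sum-δ e (λ _ → ∑ᴮ (λ c → Λ₀ (incQ q c)) + m * ∑ᴮ (λ c → Λ₁ (incQ q c))))
      where
      ring : ∀ d m x y x′ y′ → d * x + m * (d * y) + (d * x′ + m * (d * y′)) ≡ d * (x + x′ + m * (y + y′))
      ring = solve-∀
      copy : ∀ e′ c → Λ₀ (inc (pet e q) ∘ petE e′ c) + m * Λ₁ (inc (pet e q) ∘ petE e′ c)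
        ≡ δ e′ e * Λ₀ (incQ q c) + m * (δ e′ e * Λ₁ (incQ q c))
      copy e′ c = cong₂ (λ s t → s + m * t)
        (trans (Λ₀-cong factor) (Λ₀-* (δ e′ e) (incQ q c)))
        (trans (Λ₁-cong factor) (Λ₁-* (δ e′ e) (incQ q c)))
        where
        factor : ∀ f → inc (pet e q) (petE e′ c f) ≡ δ e′ e * incQ q c f
        factor f = sym (*-distribˡ-+ (δ e′ e) _ _)
    links : sum (λ e′ → ∑ᴮ (λ j → ∑ᴮ (λ h → k * (inc (pet e q) (conE e′ j h))))) ≡ 2 * k * ∑ᴮ (atV₁ q)
    links = trans (sum-cong-≗ (λ e′ → ring (δ e′ e) k (atV₁ q (σ e′)) (atV₁ q (true xor σ e′))))
      (trans (sum-δ e (λ e′ → 2 * k * ∑ᴮ (λ j → atV₁ q (j xor σ e′)))) (cong (2 * k *_) (∑ᴮ-xor (σ e) (atV₁ q))))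
      where
      ring : ∀ d k x y → k * (d * x + 0) + k * (d * x + 0) + (k * (d * y + 0) + k * (d * y + 0)) ≡ d * (2 * k * (x + y))
      ring = solve-∀

  H-regular : Regular (4 * k) H
  H-regular w = trans (cong (degree H) (sym (enc-dec w))) (trans (degree-enc (dec w)) (total-inc (dec w)))

  handshake : V G * 3 ≡ nE G * 2
  handshake = begin
    V G * 3                                                      ≡⟨ sum-const (V G) 3 ⟨
    sum {V G} (λ _ → 3)                                          ≡⟨ sum-cong-≗ ends-sum ⟨
    sum (λ v → sum (λ e → ∑ᴮ (λ j → at-end e j v)))              ≡⟨ ∑-comm (λ v e → ∑ᴮ (λ j → at-end e j v)) ⟩
    sum (λ e → sum (λ v → ∑ᴮ (λ j → at-end e j v)))
      ≡⟨ sum-cong-≗ (λ e → trans (∑-distrib-+ (at-end e false) (at-end e true))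
           (cong₂ _+_ (sum-δʳ (endpt G e false)) (sum-δʳ (endpt G e true)))) ⟩
    sum {nE G} (λ _ → 2)                                         ≡⟨ sum-const (nE G) 2 ⟩
    nE G * 2                                                     ∎
    where open ≡-Reasoning

  -- By the handshake lemma 3|V| = 2|E|, so N = 3|V| + 19|E| = 21|E|.
  N-even : Even (nE G) → 2 ∣ N
  N-even even = subst (2 ∣_) (sym (trans (cong (_+ nE G * 19) handshake) (ring (nE G))))
    (∣m⇒∣m*n 21 (m%n≡0⇒n∣m (nE G) 2 even))
    where
    ring : ∀ e → e * 2 + e * 19 ≡ e * 21
    ring = solve-∀

-- Edge connectivity

-- At concrete vertices `lookup` and `tabulate` cancel by computation; only the clause quantified
-- over all vertices needs rewriting.
cutBound : ∀ s → CutBound s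
cutBound s = proj₁ bound , choice (proj₂ bound)
  where
  bound = subset-cutBound (tabulate s)
  choice : ((∀ p → Vec.lookup (tabulate s) p ≡ s u₁) ⊎ ((s u₁ xor s v₁ ≡ true) ⊎ ((4 ≤ Λ₀ (χ s)) × (4 ≤ Λ₁ (χ s))))) →
    (∀ p → s p ≡ s u₁) ⊎ ((s u₁ xor s v₁ ≡ true) ⊎ ((4 ≤ Λ₀ (χ s)) × (4 ≤ Λ₁ (χ s))))
  choice (inj₁ const) = inj₁ (λ p → trans (sym (lookup∘tabulate s p)) (const p))
  choice (inj₂ rest) = inj₂ rest

-- The colours met on the walk through the gadget of an edge whose two ends both have colour t.
-- Around a closed walk the colour changes an even number of times, so at least twice unless it is
-- constant.
ClosedWalk : Subset 4 → Set
ClosedWalk (t ∷ x ∷ u ∷ y ∷ []) = (x ≡ t × u ≡ t × y ≡ t) ⊎ (2 ≤ 𝟙 (u xor x) + 𝟙 (u xor y) + (𝟙 (x xor t) + 𝟙 (y xor t)))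

closedWalk? : ∀ s → Dec (ClosedWalk s)
closedWalk? (t ∷ x ∷ u ∷ y ∷ []) = ((x ≟ᴮ t) ×-dec ((u ≟ᴮ t) ×-dec (y ≟ᴮ t))) ⊎-dec
  (2 ≤? 𝟙 (u xor x) + 𝟙 (u xor y) + (𝟙 (x xor t) + 𝟙 (y xor t)))

closedWalk : ∀ s → ClosedWalk s
closedWalk = forAllSubsets closedWalk? (from-no (anySubset? (¬? ∘ closedWalk?)))

-- The same walk with end colours t and t′: if they differ, the colour changes somewhere on the way.
Walk : Subset 5 → Set
Walk (t ∷ t′ ∷ x ∷ u ∷ y ∷ []) = 𝟙 (t xor t′) ≤ 𝟙 (u xor x) + 𝟙 (u xor y) + (𝟙 (x xor t) + 𝟙 (y xor t′))

walk? : ∀ s → Dec (Walk s)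
walk? (t ∷ t′ ∷ x ∷ u ∷ y ∷ []) = _ ≤? _

walk : ∀ s → Walk s
walk = forAllSubsets walk? (from-no (anySubset? (¬? ∘ walk?)))

𝟙-xor : ∀ x y z → 𝟙 (x xor y) ≤ 𝟙 (z xor x) + 𝟙 (z xor y)
𝟙-xor false false z = z≤n
𝟙-xor true true z = z≤n
𝟙-xor false true false = s≤s z≤n
𝟙-xor false true true = s≤s z≤n
𝟙-xor true false false = s≤s z≤n
𝟙-xor true false true = s≤s z≤n

triangle-cut : (t : Fin 3 → Bool) → ¬ (∀ x → t x ≡ t zero) → 2 ≤ total (λ p → 𝟙 (t p xor t (nxt p))) (allFin 3)
triangle-cut t nonconst with t (# 0) in eq₀ | t (# 1) in eq₁ | t (# 2) in eq₂
... | false | false | true = s≤s (s≤s z≤n)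
... | false | true | false = s≤s (s≤s z≤n)
... | false | true | true = s≤s (s≤s z≤n)
... | true | false | false = s≤s (s≤s z≤n)
... | true | false | true = s≤s (s≤s z≤n)
... | true | true | false = s≤s (s≤s z≤n)
... | false | false | false = contradiction (λ { zero → eq₀ ; (suc zero) → eq₁ ; (suc (suc zero)) → eq₂ }) nonconst
... | true | true | true = contradiction (λ { zero → eq₀ ; (suc zero) → eq₁ ; (suc (suc zero)) → eq₂ }) nonconst

qv-cover : ∀ q → (∃ λ p → qv false p ≡ q) ⊎ (∃ λ p → qv true p ≡ q)
qv-cover = from-yes (all? λ q → any? (λ p → qv false p ≟ q) ⊎-dec any? (λ p → qv true p ≟ q))

cut≡ : (G : Multigraph) (S : Subset (V G)) →
  cut G S ≡ sum (λ e → 𝟙 (Vec.lookup S (endpt G e false) xor Vec.lookup S (endpt G e true)))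
cut≡ G S = ∣tabulate∣ (λ e → Vec.lookup S (endpt G e false) xor Vec.lookup S (endpt G e true))

module Connectivity (G : Multigraph) (loopless : Loopless G) (cubic : Regular 3 G)
  (σ : Edge G → Bool) (π : Edge G → Bool → Fin 3) (valid : ValidPairs G π) (m : ℕ)
  (connected : Connected G) (bridgeless : Bridgeless G) where

  open Cubic G loopless cubic σ π valid m

  module _ (s : Node → Bool) where

    crosses : Label → ℕ
    crosses l = 𝟙 (s (proj₁ (ends l)) xor s (proj₂ (ends l)))

    split : Fin (V G) → Fin 3 → ℕ
    split v p = crosses (triE v p)

    linkCost petCost cost : Edge G → ℕ
    linkCost e = ∑ᴮ (λ j → ∑ᴮ (λ h → k * crosses (conE e j h)))
    petCost e = ∑ᴮ (λ c → Λ₀ (crosses ∘ petE e c) + m * Λ₁ (crosses ∘ petE e c))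
    cost e = petCost e + linkCost e

    cost≤ : sum cost ≤ total crosses labels
    cost≤ = ≤-trans (≤-reflexive (∑-distrib-+ petCost linkCost))
      (≤-trans (m≤n+m (sum petCost + sum linkCost) (sum (λ v → k * total (split v) (allFin 3))))
        (≤-reflexive (sym (total-labels crosses))))

    -- By `pair-used-once` the three edge ends at v run through the three pairs, which are the sides
    -- of the triangle.
    split-links : ∀ v → sum (λ e → ∑ᴮ (λ j → at-end e j v * split v (π e j))) ≡ total (split v) (allFin 3)
    split-links v = begin
      sum (λ e → ∑ᴮ (λ j → at-end e j v * split v (π e j)))
        ≡⟨ sum-cong-≗ (λ e → cong₂ _+_ (expand e false) (expand e true)) ⟩
      sum (λ e → sum (λ p → uses v p e false * split v p) + sum (λ p → uses v p e true * split v p))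
        ≡⟨ sum-cong-≗ (λ e → sym (∑-distrib-+ (λ p → uses v p e false * split v p) (λ p → uses v p e true * split v p))) ⟩
      sum (λ e → sum (λ p → uses v p e false * split v p + uses v p e true * split v p))
        ≡⟨ sum-cong-≗ (λ e → sum-cong-≗ (λ p → sym (*-distribʳ-+ (split v p) (uses v p e false) (uses v p e true)))) ⟩
      sum (λ e → sum (λ p → ∑ᴮ (uses v p e) * split v p))
        ≡⟨ ∑-comm (λ e p → ∑ᴮ (uses v p e) * split v p) ⟩
      sum (λ p → sum (λ e → ∑ᴮ (uses v p e) * split v p))
        ≡⟨ sum-cong-≗ (λ p → trans (sym (*-distribʳ-sum (split v p) (λ e → ∑ᴮ (uses v p e))))
             (trans (cong (_* split v p) (pair-used-once v p)) (*-identityˡ (split v p)))) ⟩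
      sum (split v) ∎
      where
      open ≡-Reasoning
      expand : ∀ e j → at-end e j v * split v (π e j) ≡ sum (λ p → uses v p e j * split v p)
      expand e j = begin
        at-end e j v * split v (π e j)                              ≡⟨ cong (at-end e j v *_) (sum-δˡ (π e j) (split v)) ⟨
        at-end e j v * sum (λ p → δ (π e j) p * split v p)          ≡⟨ sum-*ˡ (at-end e j v) (λ p → δ (π e j) p * split v p) ⟨
        sum (λ p → at-end e j v * (δ (π e j) p * split v p))
          ≡⟨ sum-cong-≗ (λ p → sym (*-assoc (at-end e j v) (δ (π e j) p) (split v p))) ⟩
        sum (λ p → uses v p e j * split v p)                        ∎

    -- Whatever the colour of its other end, a link onto a split pair is cut k times.
    split-triangle : ∀ v → ¬ (∀ x → s (tri v x) ≡ s (tri v zero)) → 4 * k ≤ total crosses labels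
    split-triangle v nonconst = begin
      4 * k                                                            ≡⟨ ring k ⟩
      k * 2 + k * 2                                                    ≤⟨ +-mono-≤ (*-monoʳ-≤ k two) (*-monoʳ-≤ k two) ⟩
      k * τ v + k * τ v                                                ≡⟨ cong (λ x → k * τ v + k * x) (split-links v) ⟨
      k * τ v + k * sum (λ e → ∑ᴮ (λ j → at-end e j v * split v (π e j)))
        ≡⟨ cong (k * τ v +_) (sum-*ˡ k (λ e → ∑ᴮ (λ j → at-end e j v * split v (π e j)))) ⟨
      k * τ v + sum (λ e → k * ∑ᴮ (λ j → at-end e j v * split v (π e j)))
        ≤⟨ +-mono-≤ (term≤sum (λ v → k * τ v) v) (sum-mono link) ⟩
      sum (λ v → k * τ v) + sum linkCost
        ≤⟨ +-monoʳ-≤ (sum (λ v → k * τ v)) (m≤n+m (sum linkCost) (sum petCost)) ⟩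
      sum (λ v → k * τ v) + (sum petCost + sum linkCost)               ≡⟨ total-labels crosses ⟨
      total crosses labels                                             ∎
      where
      open ≤-Reasoning
      τ : Fin (V G) → ℕ
      τ v = total (split v) (allFin 3)
      ring : ∀ k → 4 * k ≡ k * 2 + k * 2
      ring = solve-∀
      two : 2 ≤ τ v
      two = triangle-cut (λ x → s (tri v x)) nonconst
      linkEnd : ∀ e j → k * (at-end e j v * split v (π e j)) ≤ ∑ᴮ (λ h → k * crosses (conE e j h))
      linkEnd e j = ≤-trans (*-monoʳ-≤ k bound) (≤-reflexive (*-distribˡ-+ k (crosses (conE e j false)) _))
        where
        bound : at-end e j v * split v (π e j) ≤ ∑ᴮ (λ h → crosses (conE e j h))
        bound with endpt G e j ≟ v
        ... | yes refl = ≤-trans (≤-reflexive (*-identityˡ (split v (π e j))))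
                           (𝟙-xor (s (tri v (π e j))) (s (tri v (nxt (π e j)))) (s (pet e (qv (j xor σ e) v₁))))
        ... | no _ = z≤n
      link : ∀ e → k * ∑ᴮ (λ j → at-end e j v * split v (π e j)) ≤ linkCost e
      link e = ≤-trans (≤-reflexive (*-distribˡ-+ k (at-end e false v * split v (π e false)) _))
        (+-mono-≤ (linkEnd e false) (linkEnd e true))

    module Unsplit (const : ∀ v x → s (tri v x) ≡ s (tri v zero)) where

      t : Fin (V G) → Bool
      t v = s (tri v zero)

      t₀ t₁ : Edge G → Bool
      t₀ e = t (endpt G e false)
      t₁ e = t (endpt G e true)

      z : Edge G → Bool → Bool
      z e c = s (pet e (qv c v₁))

      u : Edge G → Bool
      u e = s (pet e zero)

      -- The number of colour changes on the walk from one end of e through v₁, u₁ and the other v₁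
      -- to the other end; σ only decides which copy comes first.
      changes : Edge G → ℕ
      changes e = 𝟙 (u e xor z e (false xor σ e)) + 𝟙 (u e xor z e (true xor σ e))
                + (𝟙 (z e (false xor σ e) xor t₀ e) + 𝟙 (z e (true xor σ e) xor t₁ e))

      copyCost : Edge G → Bool → ℕ
      copyCost e c = Λ₀ (crosses ∘ petE e c) + m * Λ₁ (crosses ∘ petE e c)

      scale : ∀ {x y z} → x ≤ y → x ≤ z → k * x ≤ y + m * z
      scale {x} x≤y x≤z = +-mono-≤ x≤y (*-monoʳ-≤ m x≤z)

      -- u₁ has the same position in both copies.
      copyBound : ∀ e c → CutBound (λ p → s (pet e (qv c p))) × (s (pet e (qv c u₁)) ≡ u e)
      copyBound e false = cutBound _ , refl
      copyBound e true = cutBound _ , refl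

      copy≥ : ∀ e c → k * (2 * 𝟙 (u e xor z e c)) ≤ copyCost e c
      copy≥ e c with copyBound e c
      ... | ((≤Λ₀ , ≤Λ₁) , _) , eq = subst (λ x → k * (2 * 𝟙 (x xor z e c)) ≤ copyCost e c) eq
        (scale {y = Λ₀ (crosses ∘ petE e c)} ≤Λ₀ ≤Λ₁)

      -- Equal colours at u₁ and v₁ exclude the separating alternative of `CutBound`.
      copy-same : ∀ e c → z e c ≡ u e → (∀ p → s (pet e (qv c p)) ≡ u e) ⊎ (k * 4 ≤ copyCost e c)
      copy-same e c z≡u with copyBound e c
      ... | (_ , inj₁ same) , eq = inj₁ (λ p → trans (same p) eq)
      ... | (_ , inj₂ (inj₁ differ)) , eq = contradiction
        (trans (sym differ) (trans (cong₂ _xor_ eq z≡u) (xor-same (u e)))) (λ ())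
        where
        xor-same : ∀ x → x xor x ≡ false
        xor-same false = refl
        xor-same true = refl
      ... | (_ , inj₂ (inj₂ (≤Λ₀ , ≤Λ₁))) , eq = inj₂ (scale {y = Λ₀ (crosses ∘ petE e c)} ≤Λ₀ ≤Λ₁)

      link≡ : ∀ e j → ∑ᴮ (λ h → k * crosses (conE e j h)) ≡ k * (2 * 𝟙 (z e (j xor σ e) xor t (endpt G e j)))
      link≡ e j = trans (cong₂ (λ x y → k * 𝟙 (z e (j xor σ e) xor x) + k * 𝟙 (z e (j xor σ e) xor y))
          (const _ (π e j)) (const _ (nxt (π e j))))
        (ring k (𝟙 (z e (j xor σ e) xor t (endpt G e j))))
        where
        ring : ∀ k x → k * x + k * x ≡ k * (2 * x)
        ring = solve-∀

      -- A change between u₁ and v₁ costs 2k by the cut bound for that copy, and a change between v₁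
      -- and an unsplit triangle cuts all 2k links there.
      changes≤ : ∀ e → 2 * k * changes e ≤ cost e
      changes≤ e = begin
        2 * k * changes e
          ≡⟨ ring k (𝟙 (u e xor z e (false xor σ e))) (𝟙 (u e xor z e (true xor σ e)))
                    (𝟙 (z e (false xor σ e) xor t₀ e)) (𝟙 (z e (true xor σ e) xor t₁ e)) ⟩
        ∑ᴮ (λ j → k * (2 * 𝟙 (u e xor z e (j xor σ e)))) + ∑ᴮ (λ j → k * (2 * 𝟙 (z e (j xor σ e) xor t (endpt G e j))))
          -- The two copies are listed by the end of e that they serve; `∑ᴮ-xor` lists them by copy.
          ≡⟨ cong₂ _+_ (∑ᴮ-xor (σ e) (λ c → k * (2 * 𝟙 (u e xor z e c)))) (cong₂ _+_ (sym (link≡ e false)) (sym (link≡ e true))) ⟩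
        ∑ᴮ (λ c → k * (2 * 𝟙 (u e xor z e c))) + linkCost e
          ≤⟨ +-monoˡ-≤ (linkCost e) (+-mono-≤ (copy≥ e false) (copy≥ e true)) ⟩
        cost e ∎
        where
        open ≤-Reasoning
        ring : ∀ k a b c d → 2 * k * (a + b + (c + d)) ≡ (k * (2 * a) + k * (2 * b)) + (k * (2 * c) + k * (2 * d))
        ring = solve-∀

      crossing≤ : ∀ e → 2 * k * 𝟙 (t₀ e xor t₁ e) ≤ cost e
      crossing≤ e = ≤-trans
        (*-monoʳ-≤ (2 * k) (walk (t₀ e ∷ t₁ e ∷ z e (false xor σ e) ∷ u e ∷ z e (true xor σ e) ∷ []))) (changes≤ e)

      -- Two changes on the closed walk already cost 4k. Without a change, each copy is constant or
      -- costs 4k alone.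
      uniform : ∀ e → t₁ e ≡ t₀ e → (∀ q → s (pet e q) ≡ t₀ e) ⊎ (4 * k ≤ cost e)
      uniform e t≡ with closedWalk (t₀ e ∷ z e (false xor σ e) ∷ u e ∷ z e (true xor σ e) ∷ [])
      ... | inj₂ 2≤ = inj₂ (≤-trans (≤-reflexive (ring k)) (≤-trans (*-monoʳ-≤ (2 * k) 2≤changes) (changes≤ e)))
        where
        ring : ∀ k → 4 * k ≡ 2 * k * 2
        ring = solve-∀
        2≤changes : 2 ≤ changes e
        2≤changes = subst (λ y → 2 ≤ 𝟙 (u e xor z e (false xor σ e)) + 𝟙 (u e xor z e (true xor σ e))
                + (𝟙 (z e (false xor σ e) xor t₀ e) + 𝟙 (z e (true xor σ e) xor y))) (sym t≡) 2≤
      ... | inj₁ (z≡ , u≡ , z′≡) = conclude (copy-same e false (z≡u false)) (copy-same e true (z≡u true))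
        where
        z≡u : ∀ c → z e c ≡ u e
        z≡u c = trans (∀-xor (σ e) (z e) z≡ z′≡ c) (sym u≡)
        conclude : (∀ p → s (pet e (qv false p)) ≡ u e) ⊎ (k * 4 ≤ copyCost e false) →
                   (∀ p → s (pet e (qv true p)) ≡ u e) ⊎ (k * 4 ≤ copyCost e true) →
                   (∀ q → s (pet e q) ≡ t₀ e) ⊎ (4 * k ≤ cost e)
        conclude (inj₂ big) _ = inj₂ (≤-trans (≤-reflexive (*-comm 4 k))
          (≤-trans big (≤-trans (m≤m+n (copyCost e false) (copyCost e true)) (m≤m+n (petCost e) (linkCost e)))))
        conclude (inj₁ _) (inj₂ big) = inj₂ (≤-trans (≤-reflexive (*-comm 4 k))
          (≤-trans big (≤-trans (m≤n+m (copyCost e true) (copyCost e false)) (m≤m+n (petCost e) (linkCost e)))))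
        conclude (inj₁ same) (inj₁ same′) = inj₁ colour
          where
          colour : ∀ q → s (pet e q) ≡ t₀ e
          colour q with qv-cover q
          ... | inj₁ (p , refl) = trans (same p) u≡
          ... | inj₂ (p , refl) = trans (same′ p) u≡

      root : Fin (V G)
      root = fromℕ< (proj₁ connected)

      -- Both colours occur on G, so connectedness gives one crossing edge, and a single one would
      -- be a bridge.
      two-crossings : ∀ v → t v ≢ t root → 2 ≤ sum (λ e → 𝟙 (t₀ e xor t₁ e))
      two-crossings v t≢ = subst (2 ≤_) cut-t
        (≤∧≢⇒< (proj₂ connected (tabulate t) inside outside) (bridgeless (tabulate t) ∘ sym))
        where
        cut-t : cut G (tabulate t) ≡ sum (λ e → 𝟙 (t₀ e xor t₁ e))
        cut-t = trans (cut≡ G (tabulate t)) (sum-cong-≗ λ e → cong 𝟙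
          (cong₂ _xor_ (lookup∘tabulate t (endpt G e false)) (lookup∘tabulate t (endpt G e true))))
        side : ∀ c → ∃ λ w → t w ≡ c
        side c with t v ≟ᴮ c | t root ≟ᴮ c
        ... | yes eq | _ = v , eq
        ... | no _ | yes eq = root , eq
        ... | no ≢c | no ≢c′ = contradiction (trans (¬-not ≢c) (sym (¬-not ≢c′))) t≢
        inside : Nonempty (tabulate t)
        inside with side true
        ... | w , eq = w , lookup⇒[]= w (tabulate t) (trans (lookup∘tabulate t w) eq)
        outside : Nonempty (∁ (tabulate t))
        outside with side false
        ... | w , eq = w , x∉p⇒x∈∁p λ w∈ →
          contradiction (trans (sym ([]=⇒lookup w∈)) (trans (lookup∘tabulate t w) eq)) (λ ())

      -- If the colouring of G is not constant, two crossing edges cost 2k each. If it is constant,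
      -- some gadget contains a vertex of the other colour, since both colours occur, and that
      -- gadget alone costs 4k.
      unsplit : (∃ λ w → s w ≡ true) → (∃ λ w → s w ≡ false) → 4 * k ≤ sum cost
      unsplit (w , w∈) (w′ , w′∉) with all? (λ v → t v ≟ᴮ t root)
      ... | no ¬same with ¬∀⟶∃¬ _ _ (λ v → t v ≟ᴮ t root) ¬same
      ... | v , t≢ = begin
        4 * k                                      ≡⟨ ring k ⟩
        2 * k * 2                                  ≤⟨ *-monoʳ-≤ (2 * k) (two-crossings v t≢) ⟩
        2 * k * sum (λ e → 𝟙 (t₀ e xor t₁ e))      ≡⟨ sum-*ˡ (2 * k) (λ e → 𝟙 (t₀ e xor t₁ e)) ⟨
        sum (λ e → 2 * k * 𝟙 (t₀ e xor t₁ e))      ≤⟨ sum-mono crossing≤ ⟩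
        sum cost                                   ∎
        where
        open ≤-Reasoning
        ring : ∀ k → 4 * k ≡ 2 * k * 2
        ring = solve-∀
      unsplit (w , w∈) (w′ , w′∉) | yes same with all? (λ e → all? (λ q → s (pet e q) ≟ᴮ t₀ e))
      ... | yes colours = contradiction (trans (sym w∈) (trans (colour w) (trans (sym (colour w′)) w′∉))) (λ ())
        where
        colour : ∀ w → s w ≡ t root
        colour (tri v x) = trans (const v x) (same v)
        colour (pet e q) = trans (colours e q) (same (endpt G e false))
      ... | no ¬colours with ¬∀⟶∃¬ _ _ (λ e → all? (λ q → s (pet e q) ≟ᴮ t₀ e)) ¬colours
      ... | e , differ with uniform e (trans (same (endpt G e true)) (sym (same (endpt G e false))))
      ... | inj₁ same′ = contradiction same′ differ
      ... | inj₂ 4k≤ = ≤-trans 4k≤ (term≤sum cost e)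

    crosses≥ : (∃ λ w → s w ≡ true) → (∃ λ w → s w ≡ false) → 4 * k ≤ total crosses labels
    crosses≥ w w′ with all? (λ v → all? (λ x → s (tri v x) ≟ᴮ s (tri v zero)))
    ... | yes const = ≤-trans (Unsplit.unsplit const w w′) cost≤
    ... | no ¬const with ¬∀⟶∃¬ _ _ (λ v → all? (λ x → s (tri v x) ≟ᴮ s (tri v zero))) ¬const
    ... | v , nonconst = split-triangle v nonconst

  H-edgeConnected : EdgeConnected (4 * k) H
  H-edgeConnected S (w , w∈) (w′ , w′∈) = subst (4 * k ≤_) (sym cut-H)
    (crosses≥ s (dec w , trans (cong (Vec.lookup S) (enc-dec w)) ([]=⇒lookup w∈))
                (dec w′ , trans (cong (Vec.lookup S) (enc-dec w′)) (outside w′∈)))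
    where
    s : Node → Bool
    s = Vec.lookup S ∘ enc
    outside : ∀ {w} → w ∈ˢ ∁ S → Vec.lookup S w ≡ false
    outside {w} w∈∁ with Vec.lookup S w in eq
    ... | false = refl
    ... | true = contradiction (lookup⇒[]= w S eq) (x∈∁p⇒x∉p w∈∁)
    cut-H : cut H S ≡ total (crosses s) labels
    cut-H = trans (cut≡ H S) (trans (sum-lookup g (map encEnds labels)) (total-map g encEnds labels))
      where
      g : Fin N × Fin N → ℕ
      g p = 𝟙 (Vec.lookup S (proj₁ p) xor Vec.lookup S (proj₂ p))

-- Perfect matchings

allᴮ? : {P : Bool → Set} → (∀ c → Dec (P c)) → Dec (∀ c → P c)
allᴮ? P? = map′ (λ { (p , q) false → p ; (p , q) true → q }) (λ h → h false , h true) (P? false ×-dec P? true)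

total-swap : {A B : Set} (f : A → B → ℕ) (xs : List A) (ys : List B) →
  total (λ y → total (λ x → f x y) xs) ys ≡ total (λ x → total (f x) ys) xs
total-swap f [] ys = total-zero ys
total-swap f (x ∷ xs) ys = trans (total-+ (f x) (λ y → total (λ x → f x y) xs) ys) (cong (total (f x) ys +_) (total-swap f xs ys))

-- The two copies meet only in u₁, so at a vertex `suc p` the edges of the other copy do not count.
incQ-qv : ∀ c c′ (p : Fin 9) f′ → incQ (qv c (suc p)) c′ f′ ≡ total (λ f → δᴮ c′ c * δ f′ f) (incident₁₀ (suc p))
incQ-qv = from-yes (allᴮ? λ c → allᴮ? λ c′ → all? λ p → all? λ f′ →
  incQ (qv c (suc p)) c′ f′ ≟ᴺ total (λ f → δᴮ c′ c * δ f′ f) (incident₁₀ (suc p)))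

incQ-u₁ : ∀ c′ f′ → incQ zero c′ f′ ≡ ∑ᴮ (λ c → total (λ f → δᴮ c′ c * δ f′ f) (incident₁₀ u₁))
incQ-u₁ = from-yes (allᴮ? λ c′ → all? λ f′ → incQ zero c′ f′ ≟ᴺ ∑ᴮ (λ c → total (λ f → δᴮ c′ c * δ f′ f) (incident₁₀ u₁)))

-- The link at end j enters copy j xor σ, so copy c serves end c xor σ.
link-qv : ∀ j s c (p : Fin 9) → δ (qv (j xor s) v₁) (qv c (suc p)) ≡ δ v₁ (suc p) * δᴮ j (c xor s)
link-qv = from-yes (allᴮ? λ j → allᴮ? λ s → allᴮ? λ c → all? λ p →
  δ (qv (j xor s) v₁) (qv c (suc p)) ≟ᴺ δ v₁ (suc p) * δᴮ j (c xor s))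

link-u₁ : ∀ c → δ (qv c v₁) zero ≡ 0
link-u₁ false = refl
link-u₁ true = refl

tight : ∀ {x y x̄ ȳ} → x ≤ x̄ → y ≤ ȳ → x + y ≡ x̄ + ȳ → x ≡ x̄
tight {x} {y} {x̄} {ȳ} x≤ y≤ eq = ≤-antisym x≤
  (+-cancelʳ-≤ y x̄ x (≤-trans (+-monoʳ-≤ x̄ y≤) (≤-reflexive (sym eq))))

sum-∣ : ∀ {n d} (f : Fin n → ℕ) → (∀ i → d ∣ f i) → d ∣ sum f
sum-∣ {zero} f d∣ = _ ∣0
sum-∣ {suc n} f d∣ = ∣m∣n⇒∣m+n (d∣ zero) (sum-∣ (f ∘ suc) (d∣ ∘ suc))

odd-not-even : ∀ n → ¬ (2 ∣ n * 2 + 1)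
odd-not-even n 2∣ = from-no (2 ∣? 1) (∣m+n∣m⇒∣n 2∣ (divides n refl))

module Matchings (G : Multigraph) (loopless : Loopless G) (cubic : Regular 3 G)
  (σ : Edge G → Bool) (π : Edge G → Bool → Fin 3) (valid : ValidPairs G π) (m : ℕ) where

  open Cubic G loopless cubic σ π valid m

  -- `isTri`, `isPet` and `isCon` are weights whose totals over a matching count its edges of each
  -- kind. `isCon e j` merges the links to both vertices of the pair at that end.
  isTri : Fin (V G) → Label → ℕ
  isTri v (triE v′ p) = δ v′ v
  isTri v (petE _ _ _) = 0
  isTri v (conE _ _ _) = 0

  isPet : Edge G → Bool → Fin 14 → Label → ℕ
  isPet e c f (triE _ _) = 0
  isPet e c f (petE e′ c′ f′) = δ e′ e * (δᴮ c′ c * δ f′ f)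
  isPet e c f (conE _ _ _) = 0

  isCon : Edge G → Bool → Label → ℕ
  isCon e j (triE _ _) = 0
  isCon e j (petE _ _ _) = 0
  isCon e j (conE e′ j′ h) = δ e′ e * δᴮ j′ j

  -- An identity label by label: totalled over a perfect matching, it becomes a star equation of the
  -- Petersen graph in which the links play u₁v₁.
  inc-copy : ∀ e c (p : Fin 9) l → inc (pet e (qv c (suc p))) l ≡
    total (λ f → isPet e c f l) (incident₁₀ (suc p)) + δ v₁ (suc p) * isCon e (c xor σ e) l
  inc-copy e c p (triE v q) = sym (cong₂ _+_ (total-zero (incident₁₀ (suc p))) (*-zeroʳ (δ v₁ (suc p))))
  inc-copy e c p (petE e′ c′ f′) = begin
    δ e′ e * δ (qv c′ (src f′)) (qv c (suc p)) + δ e′ e * δ (qv c′ (tgt f′)) (qv c (suc p))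
      ≡⟨ *-distribˡ-+ (δ e′ e) (δ (qv c′ (src f′)) (qv c (suc p))) (δ (qv c′ (tgt f′)) (qv c (suc p))) ⟨
    δ e′ e * incQ (qv c (suc p)) c′ f′
      ≡⟨ cong (δ e′ e *_) (incQ-qv c c′ p f′) ⟩
    δ e′ e * total (λ f → δᴮ c′ c * δ f′ f) (incident₁₀ (suc p))
      ≡⟨ total-* (δ e′ e) (λ f → δᴮ c′ c * δ f′ f) (incident₁₀ (suc p)) ⟨
    total (λ f → δ e′ e * (δᴮ c′ c * δ f′ f)) (incident₁₀ (suc p))
      ≡⟨ trans (cong (total (λ f → δ e′ e * (δᴮ c′ c * δ f′ f)) (incident₁₀ (suc p)) +_) (*-zeroʳ (δ v₁ (suc p)))) (+-identityʳ _) ⟨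
    total (λ f → δ e′ e * (δᴮ c′ c * δ f′ f)) (incident₁₀ (suc p)) + δ v₁ (suc p) * 0 ∎
    where open ≡-Reasoning
  inc-copy e c p (conE e′ j′ h) = begin
    δ e′ e * δ (qv (j′ xor σ e′) v₁) (qv c (suc p)) + 0
      ≡⟨ +-identityʳ _ ⟩
    δ e′ e * δ (qv (j′ xor σ e′) v₁) (qv c (suc p))
      ≡⟨ δ-subst e′ e (λ e′ → δ (qv (j′ xor σ e′) v₁) (qv c (suc p))) ⟩
    δ e′ e * δ (qv (j′ xor σ e) v₁) (qv c (suc p))
      ≡⟨ cong (δ e′ e *_) (link-qv j′ (σ e) c p) ⟩
    δ e′ e * (δ v₁ (suc p) * δᴮ j′ (c xor σ e))
      ≡⟨ ring (δ e′ e) (δ v₁ (suc p)) (δᴮ j′ (c xor σ e)) ⟩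
    δ v₁ (suc p) * (δ e′ e * δᴮ j′ (c xor σ e))
      ≡⟨ cong (_+ δ v₁ (suc p) * (δ e′ e * δᴮ j′ (c xor σ e))) (total-zero (incident₁₀ (suc p))) ⟨
    total (λ _ → 0) (incident₁₀ (suc p)) + δ v₁ (suc p) * (δ e′ e * δᴮ j′ (c xor σ e)) ∎
    where
    open ≡-Reasoning
    ring : ∀ x y z → x * (y * z) ≡ y * (x * z)
    ring = solve-∀

  inc-u₁ : ∀ e l → inc (pet e zero) l ≡ ∑ᴮ (λ c → total (λ f → isPet e c f l) (incident₁₀ u₁))
  inc-u₁ e (triE v q) = refl
  inc-u₁ e (petE e′ c′ f′) = begin
    δ e′ e * δ (qv c′ (src f′)) zero + δ e′ e * δ (qv c′ (tgt f′)) zero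
      ≡⟨ *-distribˡ-+ (δ e′ e) (δ (qv c′ (src f′)) zero) (δ (qv c′ (tgt f′)) zero) ⟨
    δ e′ e * incQ zero c′ f′
      ≡⟨ cong (δ e′ e *_) (incQ-u₁ c′ f′) ⟩
    δ e′ e * ∑ᴮ (λ c → total (λ f → δᴮ c′ c * δ f′ f) (incident₁₀ u₁))
      ≡⟨ *-distribˡ-+ (δ e′ e) (total (λ f → δᴮ c′ false * δ f′ f) (incident₁₀ u₁)) _ ⟩
    ∑ᴮ (λ c → δ e′ e * total (λ f → δᴮ c′ c * δ f′ f) (incident₁₀ u₁))
      ≡⟨ cong₂ _+_ (total-* (δ e′ e) (λ f → δᴮ c′ false * δ f′ f) (incident₁₀ u₁))
                   (total-* (δ e′ e) (λ f → δᴮ c′ true * δ f′ f) (incident₁₀ u₁)) ⟨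
    ∑ᴮ (λ c → total (λ f → isPet e c f (petE e′ c′ f′)) (incident₁₀ u₁)) ∎
    where open ≡-Reasoning
  inc-u₁ e (conE e′ j′ h) = trans (+-identityʳ _) (trans (cong (δ e′ e *_) (link-u₁ (j′ xor σ e′))) (*-zeroʳ (δ e′ e)))

  -- A triangle edge has both ends among the three vertices and a link has one. Modulo 2, only links
  -- count.
  inc-triangle : ∀ v l → sum (λ x → inc (tri v x) l) ≡
    2 * isTri v l + sum (λ e → ∑ᴮ (λ j → at-end e j v * isCon e j l))
  inc-triangle v (triE v′ p) = begin
    sum (λ x → δ v′ v * δ p x + δ v′ v * δ (nxt p) x)
      ≡⟨ ∑-distrib-+ (λ x → δ v′ v * δ p x) (λ x → δ v′ v * δ (nxt p) x) ⟩
    sum (λ x → δ v′ v * δ p x) + sum (λ x → δ v′ v * δ (nxt p) x)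
      ≡⟨ cong₂ _+_ (one p) (one (nxt p)) ⟩
    δ v′ v + δ v′ v
      ≡⟨ ring (δ v′ v) ⟩
    2 * δ v′ v + 0
      ≡⟨ cong (2 * δ v′ v +_) (sum-zero {nE G} _ (λ e → cong₂ _+_ (*-zeroʳ (at-end e false v)) (*-zeroʳ (at-end e true v)))) ⟨
    2 * δ v′ v + sum (λ e → ∑ᴮ (λ j → at-end e j v * 0)) ∎
    where
    open ≡-Reasoning
    one : ∀ p → sum (λ x → δ v′ v * δ p x) ≡ δ v′ v
    one p = trans (sum-*ˡ (δ v′ v) (δ p)) (trans (cong (δ v′ v *_) (sum-δʳ p)) (*-identityʳ _))
    ring : ∀ d → d + d ≡ 2 * d + 0
    ring = solve-∀
  inc-triangle v (petE e′ c′ f′) =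
    sym (sum-zero {nE G} _ (λ e → cong₂ _+_ (*-zeroʳ (at-end e false v)) (*-zeroʳ (at-end e true v))))
  inc-triangle v (conE e′ j′ h) = begin
    sum (λ x → at-end e′ j′ v * δ (pick h (π e′ j′)) x)
      ≡⟨ sum-*ˡ (at-end e′ j′ v) (δ (pick h (π e′ j′))) ⟩
    at-end e′ j′ v * sum (δ (pick h (π e′ j′)))
      ≡⟨ trans (cong (at-end e′ j′ v *_) (sum-δʳ (pick h (π e′ j′)))) (*-identityʳ _) ⟩
    at-end e′ j′ v
      ≡⟨ own j′ ⟩
    ∑ᴮ (λ j → at-end e′ j v * δᴮ j′ j)
      ≡⟨ sum-δˡ e′ (λ e → ∑ᴮ (λ j → at-end e j v * δᴮ j′ j)) ⟨
    sum (λ e → δ e′ e * ∑ᴮ (λ j → at-end e j v * δᴮ j′ j))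
      ≡⟨ sum-cong-≗ (λ e → ring (δ e′ e) (at-end e false v) (at-end e true v) (δᴮ j′ false) (δᴮ j′ true)) ⟩
    sum (λ e → ∑ᴮ (λ j → at-end e j v * (δ e′ e * δᴮ j′ j))) ∎
    where
    open ≡-Reasoning
    own : ∀ j′ → at-end e′ j′ v ≡ ∑ᴮ (λ j → at-end e′ j v * δᴮ j′ j)
    own false = sym (ring₀ (at-end e′ false v) (at-end e′ true v))
      where
      ring₀ : ∀ x y → x * 1 + y * 0 ≡ x
      ring₀ = solve-∀
    own true = sym (ring₁ (at-end e′ false v) (at-end e′ true v))
      where
      ring₁ : ∀ x y → x * 0 + y * 1 ≡ y
      ring₁ = solve-∀
    ring : ∀ d x y a b → d * (x * a + y * b) ≡ x * (d * a) + y * (d * b)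
    ring = solve-∀

  -- The multiplicity of the edge f in P_k.
  capacity : Fin 14 → ℕ
  capacity f = Λ₀ (λ f′ → δ f′ f) + m * Λ₁ (λ f′ → δ f′ f)

  total-isPet : ∀ e c f → total (isPet e c f) labels ≡ capacity f
  total-isPet e c f = trans (total-labels (isPet e c f)) (trans
    (cong₂ _+_ (sum-zero {V G} _ (λ v → *-zeroʳ k)) (cong₂ _+_ copies (sum-zero {nE G} _ (λ e′ → vanish k))))
    (+-identityʳ (capacity f)))
    where
    vanish : ∀ k → k * 0 + k * 0 + (k * 0 + k * 0) ≡ 0
    vanish = solve-∀
    Λ-* : ∀ d c′ → Λ₀ (λ f′ → d * (δᴮ c′ c * δ f′ f)) + m * Λ₁ (λ f′ → d * (δᴮ c′ c * δ f′ f)) ≡ d * (δᴮ c′ c * capacity f)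
    Λ-* d c′ = trans (cong₂ (λ x y → x + m * y)
      (trans (Λ₀-* d (λ f′ → δᴮ c′ c * δ f′ f)) (cong (d *_) (Λ₀-* (δᴮ c′ c) (λ f′ → δ f′ f))))
      (trans (Λ₁-* d (λ f′ → δᴮ c′ c * δ f′ f)) (cong (d *_) (Λ₁-* (δᴮ c′ c) (λ f′ → δ f′ f)))))
      (ring m d (δᴮ c′ c) (Λ₀ (λ f′ → δ f′ f)) (Λ₁ (λ f′ → δ f′ f)))
      where
      ring : ∀ m d x y z → d * (x * y) + m * (d * (x * z)) ≡ d * (x * (y + m * z))
      ring = solve-∀
    own : ∀ c → ∑ᴮ (λ c′ → δᴮ c′ c * capacity f) ≡ capacity f
    own false = trans (+-identityʳ _) (+-identityʳ _)
    own true = +-identityʳ _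
    copies : sum (λ e′ → ∑ᴮ (λ c′ → Λ₀ (isPet e c f ∘ petE e′ c′) + m * Λ₁ (isPet e c f ∘ petE e′ c′))) ≡ capacity f
    copies = trans (sum-cong-≗ (λ e′ → trans (cong₂ _+_ (Λ-* (δ e′ e) false) (Λ-* (δ e′ e) true))
                     (sym (*-distribˡ-+ (δ e′ e) (δᴮ false c * capacity f) (δᴮ true c * capacity f)))))
             (trans (sum-δ e (λ _ → ∑ᴮ (λ c′ → δᴮ c′ c * capacity f))) (own c))

  total-isCon : ∀ e j → total (isCon e j) labels ≡ 2 * k
  total-isCon e j = trans (total-labels (isCon e j)) (cong₂ _+_ (sum-zero {V G} _ (λ v → *-zeroʳ k))
    (cong₂ _+_ (sum-zero {nE G} _ (λ e′ → cong₂ _+_ (*-zeroʳ m) (*-zeroʳ m))) links))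
    where
    ring : ∀ k d x y → k * (d * x) + k * (d * x) + (k * (d * y) + k * (d * y)) ≡ d * (2 * k * (x + y))
    ring = solve-∀
    own : ∀ j → 2 * k * (δᴮ false j + δᴮ true j) ≡ 2 * k
    own false = *-identityʳ (2 * k)
    own true = *-identityʳ (2 * k)
    links : sum (λ e′ → ∑ᴮ (λ j′ → ∑ᴮ (λ h → k * isCon e j (conE e′ j′ h)))) ≡ 2 * k
    links = trans (sum-cong-≗ (λ e′ → ring k (δ e′ e) (δᴮ false j) (δᴮ true j)))
      (trans (sum-δ e (λ _ → 2 * k * (δᴮ false j + δᴮ true j))) (own j))

  -- Counts over all 4k - 2 matchings

  module _ (connected : Connected G) (disjointPMs : HasDisjointPMs (4 * k ∸ 2) H) where

    t : ℕ
    t = 4 * k ∸ 2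

    t≡ : t ≡ 2 + 4 * m
    t≡ = trans (cong (_∸ 2) (ring m)) refl
      where
      ring : ∀ m → 4 * (1 + m) ≡ 4 + 4 * m
      ring = solve-∀

    L : Fin t → List Label
    L i = select encEnds labels (proj₁ disjointPMs i)

    -- The labels of all the matchings together: an equation valid in each matching is multiplied by
    -- `t`, and disjointness bounds each count by the multiplicity in S_k(G).
    pooled : List Label
    pooled = concatMap L (allFin t)

    total-pooled : ∀ g → total g pooled ≡ sum (λ i → total g (L i))
    total-pooled g = total-concatMap-allFin g t L

    pooled≤ : ∀ g → total g pooled ≤ total g labels
    pooled≤ g = ≤-trans (≤-reflexive (total-pooled g))
      (select-disjoint encEnds g labels (proj₁ disjointPMs) (proj₂ (proj₂ disjointPMs)))

    pooled-const : ∀ g c → (∀ i → total g (L i) ≡ c) → total g pooled ≡ t * c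
    pooled-const g c eq = trans (total-pooled g) (trans (sum-cong-≗ eq) (sum-const t c))

    perfect : ∀ i w → total (inc w) (L i) ≡ 1
    perfect i w = trans (sym (trans
      (total-select encEnds (λ p → ⌊ proj₁ p ≟ enc w ⌋ ∨ ⌊ proj₂ p ≟ enc w ⌋) labels (proj₁ disjointPMs i))
      (total-cong (inc-enc w) (L i)))) (proj₁ (proj₂ disjointPMs) i (enc w))

    x : Fin t → Edge G → Bool → Fin 14 → ℕ
    x i e c f = total (isPet e c f) (L i)

    ℓ : Fin t → Edge G → Bool → ℕ
    ℓ i e c = total (isCon e (c xor σ e)) (L i)

    stars : ∀ i e c (p : Fin 9) → star (x i e c) (ℓ i e c) (suc p) ≡ 1
    stars i e c p = begin
      total (x i e c) (incident₁₀ (suc p)) + δ v₁ (suc p) * ℓ i e c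
        ≡⟨ cong₂ _+_ (total-swap (isPet e c) (incident₁₀ (suc p)) (L i)) (total-* (δ v₁ (suc p)) (isCon e (c xor σ e)) (L i)) ⟨
      total (λ l → total (λ f → isPet e c f l) (incident₁₀ (suc p))) (L i)
          + total (λ l → δ v₁ (suc p) * isCon e (c xor σ e) l) (L i)
        ≡⟨ total-+ (λ l → total (λ f → isPet e c f l) (incident₁₀ (suc p))) (λ l → δ v₁ (suc p) * isCon e (c xor σ e) l) (L i) ⟨
      total (λ l → total (λ f → isPet e c f l) (incident₁₀ (suc p)) + δ v₁ (suc p) * isCon e (c xor σ e) l) (L i)
        ≡⟨ total-cong (inc-copy e c p) (L i) ⟨
      total (inc (pet e (qv c (suc p)))) (L i)
        ≡⟨ perfect i (pet e (qv c (suc p))) ⟩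
      1 ∎
      where open ≡-Reasoning

    star-u₁ : ∀ i e → ∑ᴮ (λ c → x i e c (# 5) + x i e c (# 9)) ≡ 1
    star-u₁ i e = begin
      ∑ᴮ (λ c → x i e c (# 5) + x i e c (# 9))
        ≡⟨ cong₂ _+_ (cong (x i e false (# 5) +_) (+-identityʳ _)) (cong (x i e true (# 5) +_) (+-identityʳ _)) ⟨
      ∑ᴮ (λ c → total (x i e c) (incident₁₀ u₁))
        ≡⟨ cong₂ _+_ (total-swap (isPet e false) (incident₁₀ u₁) (L i)) (total-swap (isPet e true) (incident₁₀ u₁) (L i)) ⟨
      ∑ᴮ (λ c → total (λ l → total (λ f → isPet e c f l) (incident₁₀ u₁)) (L i))
        ≡⟨ total-+ (λ l → total (λ f → isPet e false f l) (incident₁₀ u₁))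
                   (λ l → total (λ f → isPet e true f l) (incident₁₀ u₁)) (L i) ⟨
      total (λ l → ∑ᴮ (λ c → total (λ f → isPet e c f l) (incident₁₀ u₁))) (L i)
        ≡⟨ total-cong (inc-u₁ e) (L i) ⟨
      total (inc (pet e zero)) (L i)
        ≡⟨ perfect i (pet e zero) ⟩
      1 ∎
      where open ≡-Reasoning

    matching : ∀ i e c → Matching (x i e c) (ℓ i e c)
    matching i e c = stars i e c , ≤-trans (part c) (≤-reflexive (star-u₁ i e))
      where
      w = λ c → x i e c (# 5) + x i e c (# 9)
      part : ∀ c → w c ≤ ∑ᴮ w
      part false = m≤m+n (w false) (w true)
      part true = m≤n+m (w true) (w false)

    patterns : ∀ i e c → Pattern (x i e c) (ℓ i e c)
    patterns i e c = matching-pattern (x i e c) (ℓ i e c) (matching i e c)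

    -- In the copy whose edge covers the shared u₁ the first pattern leaves no link; in the other
    -- copy it forces one.
    one-link : ∀ i e → ∑ᴮ (ℓ i e) ≡ 1
    one-link i e = numbers (w false) (w true) (ℓ i e false) (ℓ i e true)
      (star-u₁ i e) (proj₁ (patterns i e false)) (proj₁ (patterns i e true))
      where
      w = λ c → x i e c (# 5) + x i e c (# 9)
      numbers : ∀ a b c d → a + b ≡ 1 → a + c ≡ 1 → b + d ≡ 1 → c + d ≡ 1
      numbers a b c d p q r = +-cancelˡ-≡ (a + b) (c + d) 1
        (trans (ring a b c d) (trans (cong₂ _+_ q r) (cong (_+ 1) (sym p))))
        where
        ring : ∀ a b c d → a + b + (c + d) ≡ (a + c) + (b + d)
        ring = solve-∀

    X : Edge G → Bool → Fin 14 → ℕ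
    X e c f = total (isPet e c f) pooled

    linkTotal : Edge G → Bool → ℕ
    linkTotal e c = total (isCon e (c xor σ e)) pooled

    X≤ : ∀ e c f → X e c f ≤ capacity f
    X≤ e c f = ≤-trans (pooled≤ (isPet e c f)) (≤-reflexive (total-isPet e c f))

    linkTotal≤ : ∀ e c → linkTotal e c ≤ 2 * k
    linkTotal≤ e c = ≤-trans (pooled≤ (isCon e (c xor σ e))) (≤-reflexive (total-isCon e (c xor σ e)))

    linkTotal-sum : ∀ e → ∑ᴮ (linkTotal e) ≡ t
    linkTotal-sum e = trans (sym (total-+ (isCon e (false xor σ e)) (isCon e (true xor σ e)) pooled))
      (trans (pooled-const _ 1 (λ i →
        trans (total-+ (isCon e (false xor σ e)) (isCon e (true xor σ e)) (L i)) (one-link i e))) (*-identityʳ t))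

    three : ∀ e c f f′ → (∀ i → x i e c f + x i e c f′ + ℓ i e c ≡ 1) → X e c f + X e c f′ + linkTotal e c ≡ t
    three e c f f′ eq = trans (sym (split pooled)) (trans (pooled-const g 1 (λ i → trans (split (L i)) (eq i))) (*-identityʳ t))
      where
      g : Label → ℕ
      g l = isPet e c f l + isPet e c f′ l + isCon e (c xor σ e) l
      split : ∀ ls → total g ls ≡ total (isPet e c f) ls + total (isPet e c f′) ls + total (isCon e (c xor σ e)) ls
      split ls = trans (total-+ (λ l → isPet e c f l + isPet e c f′ l) (isCon e (c xor σ e)) ls)
        (cong (_+ total (isCon e (c xor σ e)) ls) (total-+ (isPet e c f) (isPet e c f′) ls))

    -- With 2k - 2 links, the capacities force v₃v₄ once and u₄u₁, v₁v₂ k times each: an odd number in total.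
    linkTotal≢ : ∀ e c → linkTotal e c ≢ 2 * m
    linkTotal≢ e c linkTotal≡ = odd-not-even (suc m) (subst (2 ∣_) sums even)
      where
      -- The two edges share the (2 + 4m) - 2m = 2 + 2m matchings that use no link at this copy.
      -- This equals their joint capacity, so both capacities are attained.
      saturated : ∀ f f′ → capacity f + capacity f′ ≡ 2 + 2 * m → X e c f + X e c f′ + linkTotal e c ≡ t → X e c f ≡ capacity f
      saturated f f′ cap eq = tight (X≤ e c f) (X≤ e c f′) (trans (+-cancelʳ-≡ (2 * m) (X e c f + X e c f′) (2 + 2 * m)
        (trans (cong (X e c f + X e c f′ +_) (sym linkTotal≡)) (trans eq (trans t≡ (ring m))))) (sym cap))
        where
        ring : ∀ m → 2 + 4 * m ≡ 2 + 2 * m + 2 * m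
        ring = solve-∀
      -- v₃v₄ lies in none of M₀, M₁, M₃, M₄ and stays single, while u₅u₂ lies in M₃ and M₄ and has
      -- multiplicity 1 + 2m.
      X₂ : X e c (# 2) ≡ 1 + m * 0
      X₂ = saturated (# 2) (# 7) (ring m) (three e c (# 2) (# 7) (λ i → proj₁ (proj₂ (patterns i e c))))
        where
        ring : ∀ m → 1 + m * 0 + (1 + m * 2) ≡ 2 + 2 * m
        ring = solve-∀
      twice : ∀ m → 1 + m * 1 + (1 + m * 1) ≡ 2 + 2 * m
      twice = solve-∀
      X₉ : X e c (# 9) ≡ 1 + m * 1
      X₉ = saturated (# 9) (# 5) (twice m) (three e c (# 9) (# 5)
        (λ i → trans (cong (_+ ℓ i e c) (+-comm (x i e c (# 9)) (x i e c (# 5)))) (proj₁ (patterns i e c))))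
      -- Here the triple is the star of v₁: v₁v₂, v₅v₁ and the links.
      X₀ : X e c (# 0) ≡ 1 + m * 1
      X₀ = saturated (# 0) (# 4) (twice m) (three e c (# 0) (# 4)
        (λ i → trans (ring (x i e c (# 0)) (x i e c (# 4)) (ℓ i e c)) (stars i e c (# 4))))
        where
        ring : ∀ x y z → x + y + z ≡ x + (y + 0) + (z + 0)
        ring = solve-∀
      g : Label → ℕ
      g l = isPet e c (# 2) l + isPet e c (# 9) l + isPet e c (# 0) l
      split : ∀ ls → total g ls ≡ total (isPet e c (# 2)) ls + total (isPet e c (# 9)) ls + total (isPet e c (# 0)) ls
      split ls = trans (total-+ (λ l → isPet e c (# 2) l + isPet e c (# 9) l) (isPet e c (# 0)) ls)
        (cong (_+ total (isPet e c (# 0)) ls) (total-+ (isPet e c (# 2)) (isPet e c (# 9)) ls))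
      even : 2 ∣ total g pooled
      even = subst (2 ∣_) (sym (total-pooled g))
        (sum-∣ (λ i → total g (L i)) (λ i → subst (2 ∣_) (sym (split (L i))) (proj₂ (proj₂ (patterns i e c)))))
      sums : total g pooled ≡ suc m * 2 + 1
      sums = trans (split pooled) (trans (cong₂ _+_ (cong₂ _+_ X₂ X₉) X₀) (ring m))
        where
        ring : ∀ m → 1 + m * 0 + (1 + m * 1) + (1 + m * 1) ≡ (1 + m) * 2 + 1
        ring = solve-∀

    -- The two ends share 4k - 2 links and have at most 2k each, so each has at least 2k - 2. That
    -- value is excluded, and two numbers of at least 2k - 1 with sum 4k - 2 both equal 2k - 1.
    linkTotal≡ : ∀ e c → linkTotal e c ≡ 1 + 2 * m
    linkTotal≡ e = λ { false → middle (above false) (above true) (linkTotal-sum e)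
             ; true → middle (above true) (above false) (trans (+-comm (linkTotal e true) (linkTotal e false)) (linkTotal-sum e)) }
      where
      atLeast : ∀ {x y} → y ≤ 2 * k → x + y ≡ t → 2 * m ≤ x
      atLeast {x} {y} y≤ eq = +-cancelʳ-≤ y (2 * m) x
        (≤-trans (+-monoʳ-≤ (2 * m) y≤) (≤-reflexive (trans (ring m) (sym (trans eq t≡)))))
        where
        ring : ∀ m → 2 * m + 2 * (1 + m) ≡ 2 + 4 * m
        ring = solve-∀
      above : ∀ c → 1 + 2 * m ≤ linkTotal e c
      above false = ≤∧≢⇒< (atLeast (linkTotal≤ e true) (linkTotal-sum e)) (linkTotal≢ e false ∘ sym)
      above true = ≤∧≢⇒<
        (atLeast (linkTotal≤ e false) (trans (+-comm (linkTotal e true) (linkTotal e false)) (linkTotal-sum e)))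
        (linkTotal≢ e true ∘ sym)
      middle : ∀ {x y} → 1 + 2 * m ≤ x → 1 + 2 * m ≤ y → x + y ≡ t → x ≡ 1 + 2 * m
      middle {x} {y} ≤x ≤y eq = sym (tight ≤x ≤y (trans (ring m) (sym (trans eq t≡))))
        where
        ring : ∀ m → 1 + 2 * m + (1 + 2 * m) ≡ 2 + 4 * m
        ring = solve-∀

    links≡ : ∀ e j → total (isCon e j) pooled ≡ 1 + 2 * m
    links≡ e j = trans (cong (λ j → total (isCon e j) pooled) (sym (xor-xor j (σ e)))) (linkTotal≡ e (j xor σ e))
      where
      xor-xor : ∀ j s → (j xor s) xor s ≡ j
      xor-xor false false = refl
      xor-xor false true = refl
      xor-xor true false = refl
      xor-xor true true = refl

    -- All matchings together cover the three vertices of one triangle 3(4k - 2) times, an even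
    -- number; but the three edge ends there bring 3(2k - 1) links, an odd number.
    contradictory-parity : ⊥
    contradictory-parity = odd-not-even (1 + 3 * m)
      (∣m+n∣m⇒∣n (subst (2 ∣_) count (divides (3 + 6 * m) (ring₁ m))) (m∣m*n (total (isTri v) pooled)))
      where
      open ≡-Reasoning
      v : Fin (V G)
      v = fromℕ< (proj₁ connected)
      ring₁ : ∀ m → 3 * (2 + 4 * m) ≡ (3 + 6 * m) * 2
      ring₁ = solve-∀
      ring₂ : ∀ m → (1 + 2 * m) * 3 ≡ (1 + 3 * m) * 2 + 1
      ring₂ = solve-∀
      ring₃ : ∀ x y c → x * c + y * c ≡ c * (x + y)
      ring₃ = solve-∀
      linkSum : total (λ l → sum (λ e → ∑ᴮ (λ j → at-end e j v * isCon e j l))) pooled ≡ (1 + 3 * m) * 2 + 1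
      linkSum = begin
        total (λ l → sum (λ e → ∑ᴮ (λ j → at-end e j v * isCon e j l))) pooled
          ≡⟨ total-sum (λ e l → ∑ᴮ (λ j → at-end e j v * isCon e j l)) pooled ⟩
        sum (λ e → total (λ l → ∑ᴮ (λ j → at-end e j v * isCon e j l)) pooled)
          ≡⟨ sum-cong-≗ (λ e → trans (total-+ (λ l → at-end e false v * isCon e false l)
                                              (λ l → at-end e true v * isCon e true l) pooled)
               (trans (cong₂ _+_ (part e false) (part e true)) (ring₃ (at-end e false v) (at-end e true v) (1 + 2 * m)))) ⟩
        sum (λ e → (1 + 2 * m) * ∑ᴮ (λ j → at-end e j v))
          ≡⟨ sum-*ˡ (1 + 2 * m) (λ e → ∑ᴮ (λ j → at-end e j v)) ⟩
        (1 + 2 * m) * sum (λ e → ∑ᴮ (λ j → at-end e j v))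
          ≡⟨ trans (cong ((1 + 2 * m) *_) (ends-sum v)) (ring₂ m) ⟩
        (1 + 3 * m) * 2 + 1 ∎
        where
        part : ∀ e j → total (λ l → at-end e j v * isCon e j l) pooled ≡ at-end e j v * (1 + 2 * m)
        part e j = trans (total-* (at-end e j v) (isCon e j) pooled) (cong (at-end e j v *_) (links≡ e j))
      count : 3 * (2 + 4 * m) ≡ 2 * total (isTri v) pooled + ((1 + 3 * m) * 2 + 1)
      count = begin
        3 * (2 + 4 * m)
          ≡⟨ cong (3 *_) (trans (sym t≡) (sym (*-identityʳ t))) ⟩
        3 * (t * 1)
          ≡⟨ sum-const 3 (t * 1) ⟨
        sum {3} (λ _ → t * 1)
          ≡⟨ sum-cong-≗ (λ x → pooled-const (inc (tri v x)) 1 (λ i → perfect i (tri v x))) ⟨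
        sum (λ x → total (inc (tri v x)) pooled)
          ≡⟨ total-sum (λ x → inc (tri v x)) pooled ⟨
        total (λ l → sum (λ x → inc (tri v x) l)) pooled
          ≡⟨ total-cong (inc-triangle v) pooled ⟩
        total (λ l → 2 * isTri v l + sum (λ e → ∑ᴮ (λ j → at-end e j v * isCon e j l))) pooled
          ≡⟨ total-+ (λ l → 2 * isTri v l) (λ l → sum (λ e → ∑ᴮ (λ j → at-end e j v * isCon e j l))) pooled ⟩
        total (λ l → 2 * isTri v l) pooled + total (λ l → sum (λ e → ∑ᴮ (λ j → at-end e j v * isCon e j l))) pooled
          ≡⟨ cong₂ _+_ (total-* 2 (isTri v) pooled) linkSum ⟩
        2 * total (isTri v) pooled + ((1 + 3 * m) * 2 + 1) ∎

-- Odd cuts and conclusion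

-- A set of odd size is nonempty, and in a graph of even order so is its complement; edge
-- connectivity then bounds its cut.
edgeConnected⇒isRGraph : ∀ {r} (G : Multigraph) → 2 ∣ V G → Regular r G → EdgeConnected r G → IsRGraph r G
edgeConnected⇒isRGraph {r} G 2∣V regular conn = regular , odd-cut
  where
  odd-cut : ∀ S → Odd ∣ S ∣ → r ≤ cut G S
  odd-cut S odd with nonempty? S | nonempty? (∁ S)
  ... | yes p | yes q = conn S p q
  ... | no empty | _ = contradiction (trans (cong (_% 2) (sym (empty⇒0 S empty))) odd) (λ ())
    where
    empty⇒0 : ∀ {n} (S : Subset n) → Empty S → ∣ S ∣ ≡ 0
    empty⇒0 {n} S empty = trans (cong ∣_∣ (Empty-unique empty)) (∣⊥∣≡0 n)
  ... | yes _ | no empty = contradiction (trans (sym (n∣m⇒m%n≡0 ∣ S ∣ 2 (subst (2 ∣_) V≡ 2∣V))) odd) (λ ())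
    where
    V≡ : V G ≡ ∣ S ∣
    V≡ = ≤-antisym (m∸n≡0⇒m≤n (trans (sym (∣∁p∣≡n∸∣p∣ S)) (trans (cong ∣_∣ (Empty-unique empty)) (∣⊥∣≡0 (V G))))) (∣p∣≤n S)

theorem2p7 : (G : Multigraph) → Loopless G → Regular 3 G → Connected G →
    Bridgeless G → Even (nE G) → (k : ℕ) → 1 ≤ k →
    (σ : Edge G → Bool) (π : Edge G → Bool → Fin 3) → ValidPairs G π →
    Loopless (S k G σ π) × EdgeConnected (4 * k) (S k G σ π) ×
    IsRGraph (4 * k) (S k G σ π) × ¬ HasDisjointPMs (4 * k ∸ 2) (S k G σ π)
-- Writing k as `suc m` makes the k - 1 copies of M₁, M₃, M₄ exactly m. All four properties are
-- shown for the labelled graph and transported along `S≡H`.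
theorem2p7 G loopless cubic connected bridgeless even (suc m) _ σ π valid =
  subst (λ H → Loopless H × EdgeConnected (4 * suc m) H × IsRGraph (4 * suc m) H × ¬ HasDisjointPMs (4 * suc m ∸ 2) H)
    (sym S≡H)
    (H-loopless , H-edgeConnected , edgeConnected⇒isRGraph H (N-even even) H-regular H-edgeConnected ,
     contradictory-parity connected)
  where
  open Cubic G loopless cubic σ π valid m
  open Connectivity G loopless cubic σ π valid m connected bridgeless
  open Matchings G loopless cubic σ π valid m
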